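{- Let $G$ be a connected graph with vertex set $V(G)=\{u_1,\dots,u_n\}$, $n\ge 2$, let $U_1,\dots,U_k$ be the non-singleton true twin equivalence classes of $G$, and let $\mathcal{H}=\{H_1,\dots,H_n\}$ be a family of graphs. Then $$\dim_l(G\circ\mathcal{H})=\sum_{i=1}^{n}\operatorname{adim}_l(H_i)+\sum_{j:\,I\cap U_j\ne\emptyset}\big(|I\cap U_j|-1\big)+\varrho(G,\mathcal{H}).$$
   Context: All graphs are finite and simple with at least one vertex. $d_G$ is the shortest-path distance ($d_G(x,y)=+\infty$ if $x,y$ lie in different components), and $d_{G,2}(x,y)=\min\{d_G(x,y),2\}$. A vertex $s$ distinguishes $x,y$ (with respect to a distance $d$) if $d(s,x)\ne d(s,y)$. For a connected graph $G$, a set $S\subseteq V(G)$ is a local metric generator if every two adjacent vertices of $G$ are distinguished w.r.t. $d_G$ by some vertex of $S$; $\dim_l(G)$ is the minimum size of such a set. A set $S\subseteq V(H)$ is a local adjacency generator of a graph $H$ if every two adjacent vertices of $H$ are distinguished w.r.t. $d_{H,2}$ by some vertex of $S$ (equivalently, for any adjacent $x,y\notin S$ some $s\in S$ is adjacent to exactly one of them); $\operatorname{adim}_l(H)$ is the minimum size of such a set, and a minimum one is a local adjacency basis. $\Phi$ denotes the class of empty (edgeless) graphs. $\mathcal{G}$ denotes the class of graphs $H$ such that for every local adjacency basis $B$ of $H$ there is $v\in V(H)$ with $B\subseteq N_H(v)$ (open neighbourhood). Vertices $x,y$ are true twins if $N[x]=N[y]$; this is an equivalence relation. The lexicographic product $G\circ\mathcal{H}$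 has vertex set $\bigcup_i \{u_i\}\times V(H_i)$, with $(u_i,v)\sim(u_j,w)$ iff $u_iu_j\in E(G)$, or $i=j$ and $vw\in E(H_i)$. Notation: $T(G)=\bigcup_{j}U_j$; $V_E=\{u_i\in V(G)-T(G): H_i\in\Phi\}$; $I=\{u_i\in V(G): H_i\in\mathcal{G}\}$; for each $j$ with $I\cap U_j\neq\emptyset$ choose (arbitrarily) one vertex of $I\cap U_j$ and let $I'_j$ be the set of the remaining vertices of $I\cap U_j$ ($I'_j=\emptyset$ otherwise); $X_E=I-\bigcup_j I'_j$. Two vertices $u_i,u_j\in X_E$ satisfy relation $\mathcal{R}$ iff $u_i\sim u_j$ and $d_G(u,u_i)=d_G(u,u_j)$ for all $u\in V(G)-(V_E\cup\{u_i,u_j\})$. $\varrho(G,\mathcal{H})$ is the minimum of $|A|$ over sets $A\subseteq X_E$ such that every pair $u_i,u_j\in X_E$ satisfying $\mathcal{R}$ is distinguished (w.r.t. $d_G$) by some vertex of $A$. -}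

module Defs where

import Data.Bool.Properties as Bool
open import Data.Fin.Base using (Fin; zero; suc; toℕ; splitAt; _↑ˡ_; _↑ʳ_)
open import Data.Fin.Properties as Fin using (_≟_; any?; all?; pigeonhole)
open import Data.Fin.Subset
open import Data.Fin.Subset.Properties
  using (_∈?_; _⊆?_; ∈⊤; anySubset?)
import Data.List.Base as List
open import Data.Nat.Base as ℕ using (ℕ; zero; suc; _≤_; _<_; _+_; _∸_; _⊓_; s≤s)
open import Data.Nat.Induction using (<-wellFounded)
open import Data.Nat.Properties as ℕ
  using (+-0-monoid; _<?_; anyUpTo?; ≮⇒≥)
open import Data.Product.Base using (∃; Σ; _×_; _,_; proj₁; map)
open import Data.Sum.Base using (inj₁; inj₂; [_,_]′)
open import Data.Vec.Base using (tabulate)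
open import Data.Vec.Properties as Vec using ()
open import Function.Base using (_∘_; id)
open import Function.Bundles using (_↔_; _⇔_; mk↔ₛ′)
open import Function.Definitions using (Injective)
open import Induction.WellFounded using (Acc; acc)
open import Relation.Binary.Core using (Rel)
open import Relation.Binary.Definitions using (Decidable; DecidableEquality; Symmetric; Irreflexive)
open import Relation.Binary.PropositionalEquality as ≡ using (_≡_; _≢_; refl; cong; subst)
open import Relation.Nullary.Construct.Add.Supremum using (_⁺; [_]; ⊤⁺; ≡-dec)
open import Relation.Nullary.Decidable
  using (Dec; yes; no; does; ¬?; map′; _×-dec_; _→-dec_; decidable-stable)
open import Relation.Nullary.Negation using (¬_; contradiction)
open import Relation.Unary as Unary using (Pred)
open import Level using (0ℓ)

open import Algebra.Properties.Monoid.Sum +-0-monoid using (sum)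

private
  variable
    n : ℕ

⟦_⟧ : {P : Pred (Fin n) 0ℓ} → Unary.Decidable P → Subset n
⟦ P? ⟧ = tabulate (does ∘ P?)

min[_,2] : ℕ ⁺ → ℕ
min[ [ k ] ,2] = k ⊓ 2
min[ ⊤⁺    ,2] = 2

Minimum : Pred (Subset n) 0ℓ → Pred (Subset n) 0ℓ
Minimum P S = P S × (∀ T → P T → ∣ S ∣ ≤ ∣ T ∣)

module _ {P : Pred (Subset n) 0ℓ} (P? : Unary.Decidable P) where

  private
    smaller? : (S : Subset n) → Dec (∃ λ (T : Subset n) → P T × ∣ T ∣ < ∣ S ∣)
    smaller? S = anySubset? (λ T → P? T ×-dec (∣ T ∣ <? ∣ S ∣))

    descend : (S : Subset n) → P S → Acc _<_ ∣ S ∣ → ∃ (Minimum P)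
    descend S pS (acc rec) with smaller? S
    ... | yes (T , pT , T<S) = descend T pT (rec T<S)
    ... | no  ∄T             = S , pS , λ T pT → ≮⇒≥ (λ T<S → ∄T (T , pT , T<S))

  opaque
    minimum : ∃ P → ∃ (Minimum P)
    minimum (S , pS) = descend S pS (<-wellFounded ∣ S ∣)

  minimumSize : ∃ P → ℕ
  minimumSize p = ∣ proj₁ (minimum p) ∣

  minimum? : Unary.Decidable (Minimum P)
  minimum? S = map′
    (λ (pS , ∄T) → pS , λ T pT → ≮⇒≥ (λ T<S → ∄T (T , pT , T<S)))
    (λ (pS , S≤) → pS , λ (T , pT , T<S) → ℕ.<⇒≱ T<S (S≤ T pT))
    (P? S ×-dec ¬? (smaller? S))

record Graph (n : ℕ) : Set₁ where
  infix 4 _~_ _~?_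
  field
    _~_    : Rel (Fin n) 0ℓ
    _~?_   : Decidable _~_
    sym    : Symmetric _~_
    irrefl : Irreflexive _≡_ _~_

  data Walk : Fin n → Fin n → ℕ → Set where
    []  : ∀ {x} → Walk x x 0
    _∷_ : ∀ {x y z k} → x ~ y → Walk y z k → Walk x z (suc k)

  Connected : Set
  Connected = ∀ x y → ∃ (Walk x y)

  N : Fin n → Subset n
  N x = ⟦ x ~?_ ⟧

  N[_] : Fin n → Subset n
  N[ x ] = ⁅ x ⁆ ∪ N x

  -- ⊤⁺ is the distance between different components.
  IsDistance : Fin n → Fin n → ℕ ⁺ → Set
  IsDistance x y [ k ] = Walk x y k × (∀ j → Walk x y j → k ≤ j)
  IsDistance x y ⊤⁺    = ∀ j → ¬ Walk x y j

  private
    walk? : ∀ x y k → Dec (Walk x y k)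
    walk? x y zero    = map′ (λ { refl → [] }) (λ { [] → refl }) (x ≟ y)
    walk? x y (suc k) = map′
      (λ (_ , e , w) → e ∷ w) (λ { (e ∷ w) → _ , e , w })
      (any? (λ z → (x ~? z) ×-dec walk? z y k))

    at : ∀ {x y k} → Walk x y k → Fin (suc k) → Fin n
    at {x} w       zero    = x
    at     (e ∷ w) (suc i) = at w i

    drop : ∀ {x y k} (w : Walk x y k) i → Walk (at w i) y (k ∸ toℕ i)
    drop w       zero    = w
    drop (e ∷ w) (suc i) = drop w i

    splice : ∀ {x y z k l} (w : Walk x y k) i → Walk (at w i) z l → Walk x z (toℕ i + l)
    splice w       zero    v = v
    splice (e ∷ w) (suc i) v = e ∷ splice w i v

    shortcut : ∀ {i j k} → i < j → j ≤ k → i + (k ∸ j) < k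
    shortcut {i} {j} {k} i<j j≤k =
      subst (i + (k ∸ j) <_) (ℕ.m+[n∸m]≡n j≤k) (ℕ.+-monoˡ-< (k ∸ j) i<j)

    shorten : ∀ {x y k} → Walk x y k → Acc _<_ k → ∃ λ j → j < n × Walk x y j
    shorten {k = k} w (acc rec) with k <? n
    ... | yes k<n = k , k<n , w
    ... | no  k≮n with pigeonhole (s≤s (≮⇒≥ k≮n)) (at w)
    ...   | i , j , i<j , eq =
      shorten (splice w i (subst (λ v → Walk v _ _) (≡.sym eq) (drop w j)))
              (rec (shortcut i<j (ℕ.≤-pred (Fin.toℕ<n j))))

    shortest : ∀ {x y} k → Walk x y k → Acc _<_ k → ∃ (IsDistance x y)
    shortest {x} {y} k w (acc rec) with anyUpTo? (walk? x y) k
    ... | yes (j , j<k , v) = shortest j v (rec j<k)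
    ... | no  ∄j            = [ k ] , w , λ j v → ≮⇒≥ (λ j<k → ∄j (j , j<k , v))

  opaque
    distance : ∀ x y → ∃ (IsDistance x y)
    distance x y with anyUpTo? (walk? x y) n
    ... | yes (k , _ , w) = shortest k w (<-wellFounded k)
    ... | no  ∄k          = ⊤⁺ , λ j w → ∄k (shorten w (<-wellFounded j))

  d : Fin n → Fin n → ℕ ⁺
  d x y = proj₁ (distance x y)

  d₂ : Fin n → Fin n → ℕ
  d₂ x y = min[ d x y ,2]

  d-separates : ∀ {x y} → d x x ≡ d x y → x ≡ y
  d-separates {x} {y} eq with distance x x | distance x y
  d-separates refl | [ 0 ]     , _       | _ , [] , _ = refl
  d-separates refl | [ suc _ ] , _ , min | _          = contradiction (min 0 []) λ ()
  d-separates refl | ⊤⁺        , ∄w      | _          = contradiction [] (∄w 0)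

  d₂-separates : ∀ {x y} → d₂ x x ≡ d₂ x y → x ≡ y
  d₂-separates {x} {y} eq with distance x x | distance x y
  d₂-separates eq | [ 0 ]           , _       | [ 0 ]           , [] , _ = refl
  d₂-separates () | [ 0 ]           , _       | [ 1 ]           , _
  d₂-separates () | [ 0 ]           , _       | [ suc (suc _) ] , _
  d₂-separates () | [ 0 ]           , _       | ⊤⁺              , _
  d₂-separates eq | [ suc _ ]       , _ , min | _               = contradiction (min 0 []) λ ()
  d₂-separates eq | ⊤⁺              , ∄w      | _               = contradiction [] (∄w 0)

  module _ {D : Set} (δ : Fin n → Fin n → D) where

    LocalGenerator : Pred (Subset n) 0ℓ
    LocalGenerator S = ∀ x y → x ~ y → ∃ λ s → s ∈ S × δ s x ≢ δ s y

    localGenerator? : DecidableEquality D → Unary.Decidable LocalGenerator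
    localGenerator? _≟ᴰ_ S = all? λ x → all? λ y →
      (x ~? y) →-dec any? λ s → (s ∈? S) ×-dec ¬? (δ s x ≟ᴰ δ s y)

    ⊤-localGenerator : (∀ {x y} → δ x x ≡ δ x y → x ≡ y) → ∃ LocalGenerator
    ⊤-localGenerator sep = ⊤ , λ x y x~y → x , ∈⊤ , λ eq → irrefl (sep eq) x~y

infix 4 _≟⁺_

_≟⁺_ : DecidableEquality (ℕ ⁺)
_≟⁺_ = ≡-dec ℕ._≟_

module _ (G : Graph n) where
  open Graph G

  LocalMetricGenerator : Pred (Subset n) 0ℓ
  LocalMetricGenerator = LocalGenerator d

  dimₗ : ℕ
  dimₗ = minimumSize (localGenerator? d _≟⁺_) (⊤-localGenerator d d-separates)

  LocalAdjacencyGenerator : Pred (Subset n) 0ℓ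
  LocalAdjacencyGenerator = LocalGenerator d₂

  adimₗ : ℕ
  adimₗ = minimumSize (localGenerator? d₂ ℕ._≟_) (⊤-localGenerator d₂ d₂-separates)

  LocalAdjacencyBasis : Pred (Subset n) 0ℓ
  LocalAdjacencyBasis = Minimum LocalAdjacencyGenerator

  localAdjacencyBasis? : Unary.Decidable LocalAdjacencyBasis
  localAdjacencyBasis? = minimum? (localGenerator? d₂ ℕ._≟_)

  Φ : Set
  Φ = ∀ x y → ¬ x ~ y

  Φ? : Dec Φ
  Φ? = all? λ x → all? λ y → ¬? (x ~? y)

  𝒢 : Set
  𝒢 = ∀ B → LocalAdjacencyBasis B → ∃ λ v → B ⊆ N v

  𝒢? : Dec 𝒢
  𝒢? = map′
    (λ ∄B B basis → decidable-stable (any? (λ v → B ⊆? N v)) (λ ∄v → ∄B (B , basis , ∄v)))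
    (λ all (B , basis , ∄v) → ∄v (all B basis))
    (¬? (anySubset? (λ B → localAdjacencyBasis? B ×-dec ¬? (any? (λ v → B ⊆? N v)))))

  TrueTwins : Rel (Fin n) 0ℓ
  TrueTwins x y = N[ x ] ≡ N[ y ]

  TrueTwinClass : Pred (Subset n) 0ℓ
  TrueTwinClass S = ∃ λ x → ∀ y → y ∈ S ⇔ TrueTwins x y

  -- U enumerates the non-singleton true twin classes without repetition.
  NonsingletonTwinClasses : ∀ {k} → (Fin k → Subset n) → Set
  NonsingletonTwinClasses U =
    Injective _≡_ _≡_ U ×
    (∀ S → (∃ λ j → U j ≡ S) ⇔ (TrueTwinClass S × ∣ S ∣ ≢ 1))

flatten : (m : Fin n → ℕ) → Σ (Fin n) (Fin ∘ m) → Fin (sum m)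
flatten m (zero  , v) = v ↑ˡ _
flatten m (suc i , v) = m zero ↑ʳ flatten (m ∘ suc) (i , v)

unflatten : (m : Fin n → ℕ) → Fin (sum m) → Σ (Fin n) (Fin ∘ m)
unflatten {suc n} m p =
  [ zero ,_ , (λ q → map suc id (unflatten (m ∘ suc) q)) ]′ (splitAt (m zero) p)

unflatten-flatten : (m : Fin n → ℕ) → ∀ u → unflatten m (flatten m u) ≡ u
unflatten-flatten m (zero , v)
  rewrite Fin.splitAt-↑ˡ (m zero) v (sum (m ∘ suc)) = refl
unflatten-flatten m (suc i , v)
  rewrite Fin.splitAt-↑ʳ (m zero) (sum (m ∘ suc)) (flatten (m ∘ suc) (i , v)) =
  cong (map suc id) (unflatten-flatten (m ∘ suc) (i , v))

flatten-unflatten : (m : Fin n → ℕ) → ∀ p → flatten m (unflatten m p) ≡ p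
flatten-unflatten {suc n} m p with splitAt (m zero) p in eq
... | inj₁ v = Fin.splitAt⁻¹-↑ˡ eq
... | inj₂ q = ≡.trans (cong (m zero ↑ʳ_) (flatten-unflatten (m ∘ suc) q)) (Fin.splitAt⁻¹-↑ʳ eq)

vertex↔ : (m : Fin n → ℕ) → Fin (sum m) ↔ Σ (Fin n) (Fin ∘ m)
vertex↔ m = mk↔ₛ′ (unflatten m) (flatten m) (unflatten-flatten m) (flatten-unflatten m)

module Lexicographic (G : Graph n) {m : Fin n → ℕ} (H : ∀ i → Graph (m i)) where
  private
    module G = Graph G
    module H i = Graph (H i)

  infix 4 _~_

  data _~_ : Rel (Σ (Fin n) (Fin ∘ m)) 0ℓ where
    across : ∀ {i j v w} → i G.~ j → (i , v) ~ (j , w)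
    within : ∀ {i v w} → H._~_ i v w → (i , v) ~ (i , w)

  _~?_ : Decidable _~_
  (i , v) ~? (j , w) with i G.~? j | i ≟ j
  ... | yes e | _        = yes (across e)
  ... | no ¬e | no  i≢j  = no λ { (across e) → ¬e e ; (within _) → i≢j refl }
  ... | no ¬e | yes refl =
    map′ within (λ { (across e) → contradiction e ¬e ; (within e) → e }) (H._~?_ i v w)

  ~-sym : Symmetric _~_
  ~-sym (across e)     = across (G.sym e)
  ~-sym (within {i} e) = within (H.sym i e)

  ~-irrefl : Irreflexive _≡_ _~_
  ~-irrefl refl (across e)     = G.irrefl refl e
  ~-irrefl refl (within {i} e) = H.irrefl i refl e

infixr 9 _∘ₗ_

-- The vertex (uᵢ , v) of the product is represented by flatten m (i , v).
_∘ₗ_ : (G : Graph n) {m : Fin n → ℕ} (H : ∀ i → Graph (m i)) → Graph (sum m)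
_∘ₗ_ G {m} H = record
  { _~_    = λ p q → unflatten m p ~ unflatten m q
  ; _~?_   = λ p q → unflatten m p ~? unflatten m q
  ; sym    = ~-sym
  ; irrefl = ~-irrefl ∘ cong (unflatten m)
  }
  where open Lexicographic G H

module _ {m : Fin n → ℕ} (H : ∀ i → Graph (m i)) where

  I : Subset n
  I = ⟦ (λ i → 𝒢? (H i)) ⟧

  -- Only the values c j with I ∩ U j nonempty matter: otherwise I′ j is empty
  -- whatever c j is.
  module _ {k} (U : Fin k → Subset n) (c : Fin k → Fin n) where

    Choice : Set
    Choice = ∀ j → Nonempty (I ∩ U j) → c j ∈ I ∩ U j

    T : Subset n
    T = ⋃ (List.tabulate U)

    V-E : Subset n
    V-E = ⟦ (λ i → Φ? (H i)) ⟧ ─ T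

    I′ : Fin k → Subset n
    I′ j = (I ∩ U j) - c j

    X-E : Subset n
    X-E = I ─ ⋃ (List.tabulate I′)

    module _ (G : Graph n) where
      open Graph G

      ℛ : Rel (Fin n) 0ℓ
      ℛ x y = x ~ y × (∀ u → u ∉ V-E ∪ (⁅ x ⁆ ∪ ⁅ y ⁆) → d u x ≡ d u y)

      ℛ? : Decidable ℛ
      ℛ? x y = (x ~? y) ×-dec all? λ u →
        ¬? (u ∈? V-E ∪ (⁅ x ⁆ ∪ ⁅ y ⁆)) →-dec (d u x ≟⁺ d u y)

      ℛ-Generator : Pred (Subset n) 0ℓ
      ℛ-Generator A =
        A ⊆ X-E ×
        (∀ x y → x ∈ X-E → y ∈ X-E → ℛ x y → ∃ λ s → s ∈ A × d s x ≢ d s y)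

      ℛ-generator? : Unary.Decidable ℛ-Generator
      ℛ-generator? A = (A ⊆? X-E) ×-dec all? λ x → all? λ y →
        (x ∈? X-E) →-dec ((y ∈? X-E) →-dec (ℛ? x y →-dec
          any? λ s → (s ∈? A) ×-dec ¬? (d s x ≟⁺ d s y)))

      X-E-generator : ∃ ℛ-Generator
      X-E-generator = X-E , id , λ x y x∈X y∈X (x~y , _) →
        x , x∈X , λ eq → irrefl (d-separates eq) x~y

      ϱ : ℕ
      ϱ = minimumSize ℛ-generator? X-E-generator

{-# OPTIONS --safe #-}

-- Distances in G ∘ₗ H are those of G between different copies and d₂ of Hᵢ within
-- the copy of Hᵢ.  Hence S generates iff every fibre Sᵢ is a local adjacency generator of Hᵢ
-- and, whenever uᵢ ~ uⱼ and both Sᵢ and Sⱼ lie in an open neighbourhood, some other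
-- nonempty fibre Sₗ has d uₗ uᵢ ≢ d uₗ uⱼ.  A basis B of Hᵢ in an open neighbourhood N v
-- is cured by a single extra vertex, namely v, so the excess of dimₗ over ∑ adimₗ is the
-- least size of a set A of indices at which one extra vertex resolves all these pairs.
-- Such an A contains all but at most one element of each I ∩ Uⱼ, and
-- by exchanging true twins the missing one may be taken to be c j; what remains of A is
-- an ℛ-generator, and conversely.
module Submission where

open import Defs
open import Data.Bool.Base using (if_then_else_)
open import Data.Fin.Base using (Fin)
open import Data.Fin.Subset using (Subset; _∩_; ∣_∣)
open import Data.Fin.Subset.Properties using (nonempty?)
open import Data.Nat.Base using (ℕ; NonZero; _+_; _∸_; _≤_)
open import Data.Nat.Properties using (+-0-monoid)
open import Algebra.Properties.Monoid.Sum +-0-monoid using (sum-syntax)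
open import Relation.Binary.PropositionalEquality using (_≡_)
open import Relation.Nullary.Decidable using (does)

import Algebra.Properties.CommutativeMonoid.Sum as CommutativeSum
open import Algebra.Properties.Monoid.Sum +-0-monoid using (sum; sum-cong-≗)
open import Data.Bool.Base using (Bool; true; false)
import Data.Bool.Properties as Bool
open import Data.Fin.Base using (zero; suc; _↑ˡ_; _↑ʳ_)
open import Data.Fin.Properties using (_≟_; any?; all?; suc-injective)
open import Data.Fin.Subset
  using (_∈_; _∉_; _⊆_; _∪_; _─_; _-_; ⋃; ⁅_⁆; ⊥; inside; outside; Nonempty; Empty)
open import Data.Fin.Subset.Properties hiding (nonempty?)
import Data.List.Base as List
open import Data.Nat.Base using (zero; suc; _<_; z≤n; s≤s)
open import Data.Nat.Properties as ℕ using (+-0-commutativeMonoid)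
open import Data.Product.Base using (∃; ∃₂; Σ; _×_; _,_; proj₁; proj₂; uncurry)
open import Data.Sum.Base using (_⊎_; inj₁; inj₂)
open import Data.Vec.Base using ([]; _∷_; here; there; tabulate; lookup)
open import Data.Vec.Properties
  using ([]=⇒lookup; lookup⇒[]=; lookup∘tabulate; tabulate∘lookup; tabulate-cong; ≡-dec)
open import Function.Base using (_∘_)
open import Function.Bundles using (Equivalence; mk⇔)
open import Level using (0ℓ)
open import Relation.Binary.Definitions using (Decidable)
open import Relation.Binary.PropositionalEquality
  using (_≢_; refl; sym; trans; cong; cong₂; subst; subst₂; module ≡-Reasoning)
open import Relation.Nullary.Construct.Add.Supremum using ([_]; ⊤⁺)
open import Relation.Nullary.Decidable
  using (Dec; yes; no; ¬?; _×-dec_; _→-dec_; decidable-stable; dec-true)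
open import Relation.Nullary.Negation using (¬_; contradiction)
open import Relation.Unary as Unary using (Pred)
open CommutativeSum +-0-commutativeMonoid using (∑-distrib-+)
open Graph using (Walk; []; _∷_; Connected; d; d₂; IsDistance; distance)

private
  variable
    n m k : ℕ

-- Finite subsets

⟦⟧⁺ : {P : Pred (Fin n) 0ℓ} (P? : Unary.Decidable P) → ∀ {x} → P x → x ∈ ⟦ P? ⟧
⟦⟧⁺ P? {x} px = lookup⇒[]= x ⟦ P? ⟧ (trans (lookup∘tabulate _ x) (dec-true (P? x) px))

⟦⟧⁻ : {P : Pred (Fin n) 0ℓ} (P? : Unary.Decidable P) → ∀ {x} → x ∈ ⟦ P? ⟧ → P x
⟦⟧⁻ P? {x} x∈ = invert (P? x) (trans (sym (lookup∘tabulate _ x)) ([]=⇒lookup x∈))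
  where
  invert : ∀ {A : Set} (A? : Dec A) → does A? ≡ true → A
  invert (yes a) refl = a

x∈p─q⇒x∉q : ∀ (p q : Subset n) {x} → x ∈ p ─ q → x ∉ q
x∈p─q⇒x∉q (_ ∷ p) (outside ∷ q) (there x∈) (there x∈q) = x∈p─q⇒x∉q p q x∈ x∈q
x∈p─q⇒x∉q (_ ∷ p) (inside  ∷ q) (there x∈) (there x∈q) = x∈p─q⇒x∉q p q x∈ x∈q

x∈p⇒∣p∣>0 : ∀ {p : Subset n} {x} → x ∈ p → 0 < ∣ p ∣
x∈p⇒∣p∣>0 x∈p = ℕ.≤-<-trans z≤n (x∈p⇒∣p-x∣<∣p∣ x∈p)

x∈⋃⁺ : (U : Fin k → Subset n) → ∀ {x} j → x ∈ U j → x ∈ ⋃ (List.tabulate U)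
x∈⋃⁺ U zero    x∈ = x∈p∪q⁺ (inj₁ x∈)
x∈⋃⁺ U (suc j) x∈ = x∈p∪q⁺ (inj₂ (x∈⋃⁺ (U ∘ suc) j x∈))

x∈⋃⁻ : (U : Fin k → Subset n) → ∀ {x} → x ∈ ⋃ (List.tabulate U) → ∃ λ j → x ∈ U j
x∈⋃⁻ {k = zero}  U x∈ = contradiction x∈ ∉⊥
x∈⋃⁻ {k = suc k} U x∈ with x∈p∪q⁻ (U zero) _ x∈
... | inj₁ x∈U₀ = zero , x∈U₀
... | inj₂ x∈⋃  = let j , x∈U = x∈⋃⁻ (U ∘ suc) x∈⋃ in suc j , x∈U

∣p∪q∣≤∣p∣+∣q∣ : (p q : Subset n) → ∣ p ∪ q ∣ ≤ ∣ p ∣ + ∣ q ∣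
∣p∪q∣≤∣p∣+∣q∣ []            []            = z≤n
∣p∪q∣≤∣p∣+∣q∣ (outside ∷ p) (outside ∷ q) = ∣p∪q∣≤∣p∣+∣q∣ p q
∣p∪q∣≤∣p∣+∣q∣ (outside ∷ p) (inside  ∷ q) rewrite ℕ.+-suc ∣ p ∣ ∣ q ∣ = s≤s (∣p∪q∣≤∣p∣+∣q∣ p q)
∣p∪q∣≤∣p∣+∣q∣ (inside  ∷ p) (outside ∷ q) = s≤s (∣p∪q∣≤∣p∣+∣q∣ p q)
∣p∪q∣≤∣p∣+∣q∣ (inside  ∷ p) (inside  ∷ q) rewrite ℕ.+-suc ∣ p ∣ ∣ q ∣ = s≤s (ℕ.m≤n⇒m≤1+n (∣p∪q∣≤∣p∣+∣q∣ p q))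

∅⇒∣p∣≤ : ∀ {p : Subset n} {a} → Empty p → ∣ p ∣ ≤ a
∅⇒∣p∣≤ {n} {p} {a} ∅ = begin
  ∣ p ∣     ≤⟨ p⊆q⇒∣p∣≤∣q∣ {q = ⊥} (λ x∈ → contradiction (_ , x∈) ∅) ⟩
  ∣ ⊥ {n} ∣ ≡⟨ ∣⊥∣≡0 n ⟩
  0         ≤⟨ z≤n ⟩
  a         ∎
  where open ℕ.≤-Reasoning

∣p∩q∣+∣p─q∣≡∣p∣ : (p q : Subset n) → ∣ p ∩ q ∣ + ∣ p ─ q ∣ ≡ ∣ p ∣
∣p∩q∣+∣p─q∣≡∣p∣ []            []            = refl
∣p∩q∣+∣p─q∣≡∣p∣ (outside ∷ p) (outside ∷ q) = ∣p∩q∣+∣p─q∣≡∣p∣ p q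
∣p∩q∣+∣p─q∣≡∣p∣ (outside ∷ p) (inside  ∷ q) = ∣p∩q∣+∣p─q∣≡∣p∣ p q
∣p∩q∣+∣p─q∣≡∣p∣ (inside  ∷ p) (outside ∷ q) = trans (ℕ.+-suc ∣ p ∩ q ∣ _) (cong suc (∣p∩q∣+∣p─q∣≡∣p∣ p q))
∣p∩q∣+∣p─q∣≡∣p∣ (inside  ∷ p) (inside  ∷ q) = cong suc (∣p∩q∣+∣p─q∣≡∣p∣ p q)

∣p∣∸1≤∣p-x∣ : (p : Subset n) (x : Fin n) → ∣ p ∣ ∸ 1 ≤ ∣ p - x ∣
∣p∣∸1≤∣p-x∣ p x = begin
  ∣ p ∣ ∸ 1                            ≡⟨ cong (_∸ 1) (∣p∩q∣+∣p─q∣≡∣p∣ p ⁅ x ⁆) ⟨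
  ∣ p ∩ ⁅ x ⁆ ∣ + ∣ p - x ∣ ∸ 1        ≤⟨ ℕ.∸-monoˡ-≤ 1 (ℕ.+-monoˡ-≤ _ (∣p∩q∣≤∣q∣ p ⁅ x ⁆)) ⟩
  ∣ ⁅ x ⁆ ∣ + ∣ p - x ∣ ∸ 1            ≡⟨ cong (λ s → s + ∣ p - x ∣ ∸ 1) (∣⁅x⁆∣≡1 x) ⟩
  ∣ p - x ∣                            ∎
  where open ℕ.≤-Reasoning

∣p∣≡1⇒x≡y : ∀ {p : Subset n} {x y} → ∣ p ∣ ≡ 1 → x ∈ p → y ∈ p → x ≡ y
∣p∣≡1⇒x≡y {p = p} {x} {y} ∣p∣≡1 x∈p y∈p with x ≟ y
... | yes x≡y = x≡y
... | no  x≢y = contradiction (begin-strict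
  0             ≤⟨ z≤n ⟩
  ∣ p - x - y ∣ <⟨ x∈p⇒∣p-x∣<∣p∣ (x∈p∧x≢y⇒x∈p-y y∈p (x≢y ∘ sym)) ⟩
  ∣ p - x ∣     ∎) (ℕ.≤⇒≯ (ℕ.≤-pred (ℕ.≤-trans (x∈p⇒∣p-x∣<∣p∣ x∈p) (ℕ.≤-reflexive ∣p∣≡1))))
  where open ℕ.≤-Reasoning

sum-mono-≤ : {f g : Fin n → ℕ} → (∀ i → f i ≤ g i) → sum f ≤ sum g
sum-mono-≤ {n = zero}  f≤g = z≤n
sum-mono-≤ {n = suc n} f≤g = ℕ.+-mono-≤ (f≤g zero) (sum-mono-≤ (f≤g ∘ suc))

∣⋃∣≤∑ : (U : Fin k → Subset n) → ∣ ⋃ (List.tabulate U) ∣ ≤ ∑[ j < k ] ∣ U j ∣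
∣⋃∣≤∑ {k = zero}  {n} U = ℕ.≤-reflexive (∣⊥∣≡0 n)
∣⋃∣≤∑ {k = suc k}     U = ℕ.≤-trans (∣p∪q∣≤∣p∣+∣q∣ (U zero) _) (ℕ.+-monoʳ-≤ ∣ U zero ∣ (∣⋃∣≤∑ (U ∘ suc)))

∣p∣≤∑∣p∩U∣+∣p─⋃U∣ : (p : Subset n) (U : Fin k → Subset n) →
  ∣ p ∣ ≤ ∑[ j < k ] ∣ p ∩ U j ∣ + ∣ p ─ ⋃ (List.tabulate U) ∣
∣p∣≤∑∣p∩U∣+∣p─⋃U∣ {k = k} p U = begin
  ∣ p ∣                                           ≡⟨ ∣p∩q∣+∣p─q∣≡∣p∣ p ⋃U ⟨
  ∣ p ∩ ⋃U ∣ + ∣ p ─ ⋃U ∣                         ≤⟨ ℕ.+-monoˡ-≤ _ (p⊆q⇒∣p∣≤∣q∣ distributes) ⟩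
  ∣ ⋃ (List.tabulate λ j → p ∩ U j) ∣ + ∣ p ─ ⋃U ∣ ≤⟨ ℕ.+-monoˡ-≤ _ (∣⋃∣≤∑ (λ j → p ∩ U j)) ⟩
  ∑[ j < k ] ∣ p ∩ U j ∣ + ∣ p ─ ⋃U ∣             ∎
  where
  open ℕ.≤-Reasoning
  ⋃U = ⋃ (List.tabulate U)
  distributes : p ∩ ⋃U ⊆ ⋃ (List.tabulate λ j → p ∩ U j)
  distributes x∈ =
    let x∈p , x∈⋃U = x∈p∩q⁻ p _ x∈
        j , x∈U    = x∈⋃⁻ U x∈⋃U
    in  x∈⋃⁺ (λ j → p ∩ U j) j (x∈p∩q⁺ (x∈p , x∈U))

-- By disjointness, removing `U zero` from `p` leaves the intersections with the later sets intact,
-- so the induction continues with `p ─ U zero`.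
∑∣p∩U∣+∣p─⋃U∣≤∣p∣ : (p : Subset n) (U : Fin k → Subset n) →
  (∀ {i j x} → x ∈ U i → x ∈ U j → i ≡ j) →
  ∑[ j < k ] ∣ p ∩ U j ∣ + ∣ p ─ ⋃ (List.tabulate U) ∣ ≤ ∣ p ∣
∑∣p∩U∣+∣p─⋃U∣≤∣p∣ {k = zero}  p U disjoint = ∣p─q∣≤∣p∣ p ⊥
∑∣p∩U∣+∣p─⋃U∣≤∣p∣ {k = suc k} p U disjoint = begin
  ∣ p ∩ U₀ ∣ + ∑[ j < k ] ∣ p ∩ U⁺ j ∣ + ∣ p ─ (U₀ ∪ ⋃U⁺) ∣
    ≡⟨ ℕ.+-assoc ∣ p ∩ U₀ ∣ _ _ ⟩
  ∣ p ∩ U₀ ∣ + (∑[ j < k ] ∣ p ∩ U⁺ j ∣ + ∣ p ─ (U₀ ∪ ⋃U⁺) ∣)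
    ≤⟨ ℕ.+-monoʳ-≤ ∣ p ∩ U₀ ∣ (ℕ.+-mono-≤
         (sum-mono-≤ λ j → p⊆q⇒∣p∣≤∣q∣ (avoids j))
         (ℕ.≤-reflexive (cong ∣_∣ (sym (p─q─r≡p─q∪r p U₀ ⋃U⁺))))) ⟩
  ∣ p ∩ U₀ ∣ + (∑[ j < k ] ∣ (p ─ U₀) ∩ U⁺ j ∣ + ∣ p ─ U₀ ─ ⋃U⁺ ∣)
    ≤⟨ ℕ.+-monoʳ-≤ ∣ p ∩ U₀ ∣ (∑∣p∩U∣+∣p─⋃U∣≤∣p∣ (p ─ U₀) U⁺ (λ x∈ x∈′ → suc-injective (disjoint x∈ x∈′))) ⟩
  ∣ p ∩ U₀ ∣ + ∣ p ─ U₀ ∣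
    ≡⟨ ∣p∩q∣+∣p─q∣≡∣p∣ p U₀ ⟩
  ∣ p ∣ ∎
  where
  open ℕ.≤-Reasoning
  U₀ = U zero
  U⁺ = U ∘ suc
  ⋃U⁺ = ⋃ (List.tabulate U⁺)
  avoids : ∀ j → p ∩ U⁺ j ⊆ (p ─ U₀) ∩ U⁺ j
  avoids j x∈ =
    let x∈p , x∈U = x∈p∩q⁻ p _ x∈
    in  x∈p∩q⁺ (x∈p∧x∉q⇒x∈p─q x∈p (λ x∈U₀ → contradiction (disjoint x∈U₀ x∈U) λ ()) , x∈U)

-- Counting by indicators and by blocks

indicator : Subset n → Fin n → ℕ
indicator p i = if lookup p i then 1 else 0

∣p∣≡∑indicator : (p : Subset n) → ∣ p ∣ ≡ sum (indicator p)
∣p∣≡∑indicator []            = refl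
∣p∣≡∑indicator (outside ∷ p) = ∣p∣≡∑indicator p
∣p∣≡∑indicator (inside  ∷ p) = cong suc (∣p∣≡∑indicator p)

indicator-∈ : ∀ {p : Subset n} {i} → i ∈ p → indicator p i ≡ 1
indicator-∈ {p = p} i∈p = cong (if_then 1 else 0) ([]=⇒lookup i∈p)

indicator-∉ : ∀ {p : Subset n} {i} → i ∉ p → indicator p i ≡ 0
indicator-∉ {p = p} {i} i∉p with lookup p i in eq
... | false = refl
... | true  = contradiction (lookup⇒[]= i p eq) i∉p

∣tabulate-+∣ : ∀ a {b} (f : Fin (a + b) → Bool) →
  ∣ tabulate f ∣ ≡ ∣ tabulate (f ∘ (_↑ˡ b)) ∣ + ∣ tabulate (f ∘ (a ↑ʳ_)) ∣
∣tabulate-+∣ zero    f = refl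
∣tabulate-+∣ (suc a) f with f zero
... | true  = cong suc (∣tabulate-+∣ a (f ∘ suc))
... | false = ∣tabulate-+∣ a (f ∘ suc)

-- `flatten` lays out the blocks one after another, so the count splits at the end of the first
-- block and recurses.
∣tabulate-flatten∣ : (m : Fin n → ℕ) (f : Fin (sum m) → Bool) →
  ∣ tabulate f ∣ ≡ ∑[ i < n ] ∣ tabulate (λ v → f (flatten m (i , v))) ∣
∣tabulate-flatten∣ {n = zero}  m f = refl
∣tabulate-flatten∣ {n = suc n} m f =
  trans (∣tabulate-+∣ (m zero) f)
        (cong (∣ tabulate (λ v → f (v ↑ˡ sum (m ∘ suc))) ∣ +_) (∣tabulate-flatten∣ (m ∘ suc) (λ q → f (m zero ↑ʳ q))))

-- Distances

module _ (G : Graph n) where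
  open Graph G using (_~_; _~?_; irrefl) renaming (sym to ~-sym)

  IsDistance-unique : ∀ {x y a b} → IsDistance G x y a → IsDistance G x y b → a ≡ b
  IsDistance-unique {a = [ k ]} {[ l ]} (w , min) (v , min′) = cong [_] (ℕ.≤-antisym (min _ v) (min′ _ w))
  IsDistance-unique {a = [ k ]} {⊤⁺}    (w , _)   ∄v         = contradiction w (∄v _)
  IsDistance-unique {a = ⊤⁺}    {[ l ]} ∄w        (v , _)    = contradiction v (∄w _)
  IsDistance-unique {a = ⊤⁺}    {⊤⁺}    _         _          = refl

  -- `distance` is opaque, so values of `d` are computed by exhibiting something that meets its
  -- specification.
  d≡ : ∀ {x y a} → IsDistance G x y a → d G x y ≡ a
  d≡ {x} {y} = IsDistance-unique (proj₂ (distance G x y))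

  d-refl : ∀ x → d G x x ≡ [ 0 ]
  d-refl x = d≡ ([] , λ _ _ → z≤n)

  d-edge : ∀ {x y} → x ~ y → d G x y ≡ [ 1 ]
  d-edge x~y = d≡ (x~y ∷ [] , λ { zero [] → contradiction x~y (irrefl refl) ; (suc _) _ → s≤s z≤n })

  far : ∀ {x y} → x ≢ y → ¬ x ~ y → ∀ {j} → Walk G x y j → 2 ≤ j
  far x≢y x≁y []            = contradiction refl x≢y
  far x≢y x≁y (e ∷ [])      = contradiction e x≁y
  far x≢y x≁y (_ ∷ (_ ∷ _)) = s≤s (s≤s z≤n)

  d-far : ∀ {x y} → x ≢ y → ¬ x ~ y → Walk G x y 2 → d G x y ≡ [ 2 ]
  d-far x≢y x≁y w = d≡ (w , λ _ → far x≢y x≁y)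

  d₂-refl : ∀ x → d₂ G x x ≡ 0
  d₂-refl x = cong min[_,2] (d-refl x)

  d₂-edge : ∀ {x y} → x ~ y → d₂ G x y ≡ 1
  d₂-edge x~y = cong min[_,2] (d-edge x~y)

  d₂-far : ∀ {x y} → x ≢ y → ¬ x ~ y → d₂ G x y ≡ 2
  d₂-far {x} {y} x≢y x≁y with distance G x y
  ... | [ k ] , w , _ = ℕ.m≥n⇒m⊓n≡n (far x≢y x≁y w)
  ... | ⊤⁺    , _     = refl

  d₂≡1⇒~ : ∀ {x y} → d₂ G x y ≡ 1 → x ~ y
  d₂≡1⇒~ {x} {y} d₂≡1 with x ~? y | x ≟ y
  ... | yes x~y | _        = x~y
  ... | no  x≁y | yes refl = contradiction (trans (sym (d₂-refl x)) d₂≡1) λ ()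
  ... | no  x≁y | no  x≢y  = contradiction (trans (sym (d₂-far x≢y x≁y)) d₂≡1) λ ()

  -- The second walk is an accumulator holding the part already reversed.
  reverse-onto : ∀ {x y z k l} → Walk G x y k → Walk G x z l → Walk G y z (k + l)
  reverse-onto []                v = v
  reverse-onto {k = suc k} {l} (e ∷ w) v =
    subst (Walk G _ _) (ℕ.+-suc k l) (reverse-onto w (~-sym e ∷ v))

  reverse : ∀ {x y k} → Walk G x y k → Walk G y x k
  reverse {k = k} w = subst (Walk G _ _) (ℕ.+-identityʳ k) (reverse-onto w [])

infix 4 _⟨_,_⟩≽_⟨_,_⟩

-- A comparison of walks rather than of distances: having it in both directions equates the
-- distances, the infinite one included, even across two different graphs.
_⟨_,_⟩≽_⟨_,_⟩ : ∀ {n m} (G : Graph n) (a b : Fin n) (G′ : Graph m) (a′ b′ : Fin m) → Set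
G ⟨ a , b ⟩≽ G′ ⟨ a′ , b′ ⟩ = ∀ {k} → Walk G a b k → ∃ λ j → j ≤ k × Walk G′ a′ b′ j

d-cong : ∀ {n m} {G : Graph n} {G′ : Graph m} {a b a′ b′} →
  G ⟨ a , b ⟩≽ G′ ⟨ a′ , b′ ⟩ → G′ ⟨ a′ , b′ ⟩≽ G ⟨ a , b ⟩ → d G a b ≡ d G′ a′ b′
d-cong {G = G} {G′} {a} {b} {a′} {b′} to from with distance G a b
... | ⊤⁺    , ∄w      = sym (d≡ G′ (λ j v → ∄w _ (proj₂ (proj₂ (from v)))))
... | [ k ] , w , min = sym (d≡ G′ (subst (Walk G′ a′ b′) j≡k v , k≤))
  where
  j = proj₁ (to w)
  v = proj₂ (proj₂ (to w))
  k≤ : ∀ l → Walk G′ a′ b′ l → k ≤ l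
  k≤ l u = let _ , i≤l , t = from u in ℕ.≤-trans (min _ t) i≤l
  j≡k : j ≡ k
  j≡k = ℕ.≤-antisym (proj₁ (proj₂ (to w))) (k≤ j v)

d-sym : (G : Graph n) → ∀ x y → d G x y ≡ d G y x
d-sym G x y = d-cong {G = G} {G} (λ w → _ , ℕ.≤-refl , reverse G w) (λ w → _ , ℕ.≤-refl , reverse G w)

-- True twins

module _ (G : Graph n) where
  open Graph G using (_~_; _~?_; irrefl; N; N[_]) renaming (sym to ~-sym)

  twins? : Decidable (TrueTwins G)
  twins? x y = ≡-dec Bool._≟_ N[ x ] N[ y ]

  y∈N[x]⁻ : ∀ {x y} → y ∈ N[ x ] → y ≡ x ⊎ x ~ y
  y∈N[x]⁻ {x} y∈ with x∈p∪q⁻ ⁅ x ⁆ (N x) y∈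
  ... | inj₁ y∈⁅x⁆ = inj₁ (x∈⁅y⁆⇒x≡y x y∈⁅x⁆)
  ... | inj₂ y∈N   = inj₂ (⟦⟧⁻ (x ~?_) y∈N)

  twins-adjacent : ∀ {x y} → TrueTwins G x y → x ≢ y → x ~ y
  twins-adjacent {x} {y} x≈y x≢y with y∈N[x]⁻ (subst (y ∈_) (sym x≈y) (x∈p∪q⁺ (inj₁ (x∈⁅x⁆ y))))
  ... | inj₁ y≡x = contradiction (sym y≡x) x≢y
  ... | inj₂ x~y = x~y

  twin-~ : ∀ {x y z} → TrueTwins G x y → z ≢ y → x ~ z → y ~ z
  twin-~ {x} {y} {z} x≈y z≢y x~z
    with y∈N[x]⁻ (subst (z ∈_) x≈y (x∈p∪q⁺ (inj₂ (⟦⟧⁺ (x ~?_) x~z))))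
  ... | inj₁ z≡y = contradiction z≡y z≢y
  ... | inj₂ y~z = y~z

  -- Only the first edge `x ~ z` has to change: if `z` is `y` it is dropped, and otherwise `y` is
  -- adjacent to `z` as well.
  twin-≽ : ∀ {x y l} → TrueTwins G x y → l ≢ x → G ⟨ x , l ⟩≽ G ⟨ y , l ⟩
  twin-≽ x≈y l≢x []               = contradiction refl l≢x
  twin-≽ {y = y} x≈y l≢x (_∷_ {y = z} x~z w) with z ≟ y
  ... | yes refl = _ , ℕ.n≤1+n _ , w
  ... | no  z≢y  = _ , ℕ.≤-refl , twin-~ x≈y z≢y x~z ∷ w

  d-twins : ∀ {x y l} → TrueTwins G x y → l ≢ x → l ≢ y → d G l x ≡ d G l y
  d-twins {x} {y} {l} x≈y l≢x l≢y = begin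
    d G l x ≡⟨ d-sym G l x ⟩
    d G x l ≡⟨ d-cong (twin-≽ x≈y l≢x) (twin-≽ (sym x≈y) l≢y) ⟩
    d G y l ≡⟨ d-sym G y l ⟩
    d G l y ∎
    where open ≡-Reasoning

  -- Both distances are 1. Hence a vertex other than `x` and `y` that distinguishes the ends of the
  -- edge is a twin of neither.
  twin-equidistant : ∀ {l x y} → TrueTwins G l x → x ~ y → l ≢ x → l ≢ y → d G l x ≡ d G l y
  twin-equidistant l≈x x~y l≢x l≢y =
    trans (d-edge G (twins-adjacent l≈x l≢x)) (sym (d-edge G (twin-~ (sym l≈x) (l≢y ∘ sym) x~y)))

-- Nonsingleton twin classes

module TwinClasses (G : Graph n) {U : Fin k → Subset n} (classes : NonsingletonTwinClasses G U) where

  private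
    isClass : ∀ j → TrueTwinClass G (U j) × ∣ U j ∣ ≢ 1
    isClass j = Equivalence.to (proj₂ classes (U j)) (j , refl)

  class⁻ : ∀ {j x y} → x ∈ U j → y ∈ U j → TrueTwins G x y
  class⁻ {j} {x} {y} x∈ y∈ =
    let (_ , member) , _ = isClass j
    in  trans (sym (Equivalence.to (member x) x∈)) (Equivalence.to (member y) y∈)

  class⁺ : ∀ {j x y} → x ∈ U j → TrueTwins G x y → y ∈ U j
  class⁺ {j} {x} {y} x∈ x≈y =
    let (_ , member) , _ = isClass j
    in  Equivalence.from (member y) (trans (Equivalence.to (member x) x∈) x≈y)

  -- Classes that share a vertex are equal as sets, and `U` is injective.
  disjoint : ∀ {i j x} → x ∈ U i → x ∈ U j → i ≡ j
  disjoint x∈Ui x∈Uj = proj₁ classes (⊆-antisym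
    (λ y∈ → class⁺ x∈Uj (class⁻ x∈Ui y∈)) (λ y∈ → class⁺ x∈Ui (class⁻ x∈Uj y∈)))

  another : ∀ {j x} → x ∈ U j → ∃ λ y → y ∈ U j × y ≢ x
  another {j} {x} x∈ = decidable-stable (any? λ y → (y ∈? U j) ×-dec ¬? (y ≟ x)) λ ∄y →
    proj₂ (isClass j) (trans (cong ∣_∣ (⊆-antisym
      (λ {y} y∈ → subst (_∈ ⁅ x ⁆) (sym (decidable-stable (y ≟ x) λ y≢x → ∄y (y , y∈ , y≢x))) (x∈⁅x⁆ x))
      (λ y∈ → subst (_∈ U j) (sym (x∈⁅y⁆⇒x≡y x y∈)) x∈)))
      (∣⁅x⁆∣≡1 x))

  -- Were the twin class of `x` not of size 1, the enumeration `U` would list it and `x` would lie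
  -- in the union.
  twin-of-singleton : ∀ {x y} → x ∉ ⋃ (List.tabulate U) → TrueTwins G x y → x ≡ y
  twin-of-singleton {x} {y} x∉ x≈y with ∣ ⟦ twins? G x ⟧ ∣ ℕ.≟ 1
  ... | yes ≡1 = ∣p∣≡1⇒x≡y ≡1 (⟦⟧⁺ (twins? G x) refl) (⟦⟧⁺ (twins? G x) x≈y)
  ... | no  ≢1 =
    let j , Uj≡ = Equivalence.from (proj₂ classes ⟦ twins? G x ⟧)
                    ((x , λ y → mk⇔ (⟦⟧⁻ (twins? G x)) (⟦⟧⁺ (twins? G x))) , ≢1)
    in  contradiction (x∈⋃⁺ U j (subst (x ∈_) (sym Uj≡) (⟦⟧⁺ (twins? G x) refl))) x∉

-- Resolving sets and representatives of twin classes

∉∪pair⁺ : ∀ {p : Subset n} {u x y} → u ∉ p → u ≢ x → u ≢ y → u ∉ p ∪ (⁅ x ⁆ ∪ ⁅ y ⁆)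
∉∪pair⁺ {p = p} {u} {x} {y} u∉p u≢x u≢y u∈ with x∈p∪q⁻ p _ u∈
... | inj₁ u∈p = u∉p u∈p
... | inj₂ u∈xy with x∈p∪q⁻ ⁅ x ⁆ ⁅ y ⁆ u∈xy
...   | inj₁ u∈x = u≢x (x∈⁅y⁆⇒x≡y x u∈x)
...   | inj₂ u∈y = u≢y (x∈⁅y⁆⇒x≡y y u∈y)

∉∪pair⁻ : ∀ {p : Subset n} {u x y} → u ∉ p ∪ (⁅ x ⁆ ∪ ⁅ y ⁆) → u ∉ p × u ≢ x × u ≢ y
∉∪pair⁻ {u = u} u∉ =
  u∉ ∘ x∈p∪q⁺ ∘ inj₁ ,
  (λ { refl → u∉ (x∈p∪q⁺ (inj₂ (x∈p∪q⁺ (inj₁ (x∈⁅x⁆ u))))) }) ,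
  (λ { refl → u∉ (x∈p∪q⁺ (inj₂ (x∈p∪q⁺ (inj₂ (x∈⁅x⁆ u))))) })

-- I and E stand for the sets of i with Hᵢ ∈ 𝒢 and with Hᵢ edgeless: l ∉ E forces the
-- fibre over l to be nonempty, whereas for l ∈ E an extra vertex is required.
Resolving : Graph n → (I E A : Subset n) → Set
Resolving G I E A = ∀ {i j} → Graph._~_ G i j → i ∈ I → j ∈ I →
  ∃ λ l → (l ∈ A ⊎ (l ≢ i × l ≢ j × l ∉ E)) × d G l i ≢ d G l j

resolver-≢ : ∀ {A : Subset n} {l x y} {P : Set} →
  l ∈ A ⊎ (l ≢ x × l ≢ y × P) → x ∉ A → y ∉ A → l ≢ x × l ≢ y
resolver-≢ (inj₁ l∈A)             x∉A y∉A = (λ { refl → x∉A l∈A }) , (λ { refl → y∉A l∈A })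
resolver-≢ (inj₂ (l≢x , l≢y , _)) _   _   = l≢x , l≢y

module Representatives (G : Graph n) {U : Fin k → Subset n} (classes : NonsingletonTwinClasses G U)
  (c : Fin k → Fin n) {I E : Subset n} (E⊆I : E ⊆ I) where

  open TwinClasses G classes
  open Graph G using (_~_; irrefl; d-separates) renaming (sym to ~-sym)

  private
    ⋃U = ⋃ (List.tabulate U)

  -- `Rest`, `XE`, `VE`, `Related` and `RelatedGenerator` are `I′`, `X-E`, `V-E`, `ℛ` and
  -- `ℛ-Generator` for abstract `I` and `E`; once these are instantiated by the sets coming from
  -- `H`, the two versions agree by definition.
  Rest : Fin k → Subset n
  Rest j = (I ∩ U j) - c j

  private
    ⋃Rest = ⋃ (List.tabulate Rest)

  XE : Subset n
  XE = I ─ ⋃Rest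

  VE : Subset n
  VE = E ─ ⋃U

  ∈⋃Rest : ∀ {x j} → x ∈ I → x ∈ U j → x ≢ c j → x ∈ ⋃Rest
  ∈⋃Rest {j = j} x∈I x∈U x≢c = x∈⋃⁺ Rest j (x∈p∧x≢y⇒x∈p-y (x∈p∩q⁺ (x∈I , x∈U)) x≢c)

  XE⊆I : XE ⊆ I
  XE⊆I = p─q⊆p I ⋃Rest

  XE-representative : ∀ {x j} → x ∈ XE → x ∈ U j → x ≡ c j
  XE-representative {x} {j} x∈XE x∈U = decidable-stable (x ≟ c j) λ x≢c →
    x∈p─q⇒x∉q I ⋃Rest x∈XE (∈⋃Rest (XE⊆I x∈XE) x∈U x≢c)

  -- Within `U j` only `c j` can survive in `XE`, and a vertex outside all the classes has no twin
  -- but itself.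
  XE-twins : ∀ {x y} → x ∈ XE → y ∈ XE → TrueTwins G x y → x ≡ y
  XE-twins {x} x∈XE y∈XE x≈y with x ∈? ⋃U
  ... | no  x∉ = twin-of-singleton x∉ x≈y
  ... | yes x∈ = let j , x∈U = x∈⋃⁻ U x∈ in
    trans (XE-representative x∈XE x∈U) (sym (XE-representative y∈XE (class⁺ x∈U x≈y)))

  Related : Fin n → Fin n → Set
  Related x y = x ~ y × (∀ u → u ∉ VE ∪ (⁅ x ⁆ ∪ ⁅ y ⁆) → d G u x ≡ d G u y)

  RelatedGenerator : Subset n → Set
  RelatedGenerator A =
    A ⊆ XE ×
    (∀ x y → x ∈ XE → y ∈ XE → Related x y → ∃ λ s → s ∈ A × d G s x ≢ d G s y)

  ∑Rest : ℕ
  ∑Rest = ∑[ j < k ] (if does (nonempty? (I ∩ U j)) then ∣ I ∩ U j ∣ ∸ 1 else 0)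

  ∣Rest∣≤ : ∀ j → (Nonempty (I ∩ U j) → c j ∈ I ∩ U j) →
    ∣ Rest j ∣ ≤ (if does (nonempty? (I ∩ U j)) then ∣ I ∩ U j ∣ ∸ 1 else 0)
  ∣Rest∣≤ j choice with nonempty? (I ∩ U j)
  ... | yes ne = ℕ.≤-pred (begin-strict
    ∣ Rest j ∣            <⟨ x∈p⇒∣p-x∣<∣p∣ (choice ne) ⟩
    ∣ I ∩ U j ∣           ≡⟨ ℕ.m+[n∸m]≡n (x∈p⇒∣p∣>0 (choice ne)) ⟨
    suc (∣ I ∩ U j ∣ ∸ 1) ∎)
    where open ℕ.≤-Reasoning
  ... | no  ∅  = ∅⇒∣p∣≤ λ (_ , x∈) → ∅ (_ , p─q⊆p (I ∩ U j) ⁅ c j ⁆ x∈)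

  -- From an `ℛ`-generator to a resolving set

  module _ (choice : ∀ j → Nonempty (I ∩ U j) → c j ∈ I ∩ U j)
    {A : Subset n} (generator : RelatedGenerator A) where

    completion : Subset n
    completion = A ∪ ⋃Rest

    ∣completion∣≤ : ∣ completion ∣ ≤ ∑Rest + ∣ A ∣
    ∣completion∣≤ = begin
      ∣ completion ∣                    ≤⟨ ∣p∪q∣≤∣p∣+∣q∣ A _ ⟩
      ∣ A ∣ + ∣ ⋃Rest ∣                 ≤⟨ ℕ.+-monoʳ-≤ ∣ A ∣ (∣⋃∣≤∑ Rest) ⟩
      ∣ A ∣ + ∑[ j < k ] ∣ Rest j ∣     ≤⟨ ℕ.+-monoʳ-≤ ∣ A ∣ (sum-mono-≤ λ j → ∣Rest∣≤ j (choice j)) ⟩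
      ∣ A ∣ + ∑Rest                     ≡⟨ ℕ.+-comm ∣ A ∣ ∑Rest ⟩
      ∑Rest + ∣ A ∣                     ∎
      where open ℕ.≤-Reasoning

    ∉completion⇒XE : ∀ {i} → i ∈ I → i ∉ completion → i ∈ XE
    ∉completion⇒XE i∈I i∉ = x∈p∧x∉q⇒x∈p─q i∈I (i∉ ∘ x∈p∪q⁺ ∘ inj₂)

    E⇒∈completion : ∀ {x j} → x ∈ E → x ∈ U j → x ≢ c j → x ∈ completion
    E⇒∈completion x∈E x∈U x≢c = x∈p∪q⁺ (inj₂ (∈⋃Rest (E⊆I x∈E) x∈U x≢c))

    -- An edge with both ends in `I` but outside the completion joins two vertices of `XE`. If they
    -- are related, `A` distinguishes them. Otherwise some `u` outside `VE`, different from both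
    -- ends, does; it serves directly unless `u ∈ E`, and then `u` lies in a nonsingleton class,
    -- where a twin is available.
    resolving-completion : Resolving G I E completion
    resolving-completion {i} {j} i~j i∈I j∈I with i ∈? completion | j ∈? completion
    ... | yes i∈ | _ = i , inj₁ i∈ , λ eq → irrefl (d-separates eq) i~j
    ... | no _ | yes j∈ = j , inj₁ j∈ , λ eq → irrefl (sym (d-separates (sym eq))) i~j
    ... | no i∉ | no j∉ with any? (λ u → ¬? (u ∈? VE ∪ (⁅ i ⁆ ∪ ⁅ j ⁆)) ×-dec ¬? (d G u i ≟⁺ d G u j))
    ...   | no ∄u =
      let s , s∈A , d≢ = proj₂ generator i j (∉completion⇒XE i∈I i∉) (∉completion⇒XE j∈I j∉)
            (i~j , λ u u∉ → decidable-stable (d G u i ≟⁺ d G u j) λ d≢ → ∄u (u , u∉ , d≢))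
      in  s , inj₁ (x∈p∪q⁺ (inj₁ s∈A)) , d≢
    ...   | yes (u , u∉ , d≢) with ∉∪pair⁻ u∉ | u ∈? E
    ...     | _ , u≢i , u≢j | no u∉E = u , inj₂ (u≢i , u≢j , u∉E) , d≢
    ...     | u∉VE , u≢i , u≢j | yes u∈E = twin-witness
      where
      u∈⋃U : u ∈ ⋃U
      u∈⋃U = decidable-stable (u ∈? ⋃U) λ u∉⋃U → u∉VE (x∈p∧x∉q⇒x∈p─q u∈E u∉⋃U)
      -- u or one of its twins lies in the completion or carries a nonempty graph, and
      -- twins of u distinguish i and j as u does.
      twin-witness : ∃ λ l → (l ∈ completion ⊎ (l ≢ i × l ≢ j × l ∉ E)) × d G l i ≢ d G l j
      twin-witness with x∈⋃⁻ U u∈⋃U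
      ... | t , u∈U with another u∈U
      ...   | u′ , u′∈U , u′≢u with u ≟ c t
      ...     | no  u≢c  = u , inj₁ (E⇒∈completion u∈E u∈U u≢c) , d≢
      ...     | yes refl = u′ , side , λ eq → d≢ (begin
        d G u i  ≡⟨ d-sym G u i ⟩
        d G i u  ≡⟨ d-twins G u≈u′ (u≢i ∘ sym) (u′≢i ∘ sym) ⟩
        d G i u′ ≡⟨ d-sym G i u′ ⟩
        d G u′ i ≡⟨ eq ⟩
        d G u′ j ≡⟨ d-sym G u′ j ⟩
        d G j u′ ≡⟨ d-twins G u≈u′ (u≢j ∘ sym) (u′≢j ∘ sym) ⟨
        d G j u  ≡⟨ d-sym G j u ⟩
        d G u j  ∎)
        where
        open ≡-Reasoning
        u≈u′ : TrueTwins G u u′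
        u≈u′ = class⁻ u∈U u′∈U
        -- If `u′` were `i`, then `u` would be a twin of `i` and so at distance 1 from both ends of
        -- the edge.
        u′≢i : u′ ≢ i
        u′≢i refl = d≢ (twin-equidistant G u≈u′ i~j u≢i u≢j)
        u′≢j : u′ ≢ j
        u′≢j refl = d≢ (sym (twin-equidistant G u≈u′ (~-sym i~j) u≢j u≢i))
        side : u′ ∈ completion ⊎ (u′ ≢ i × u′ ≢ j × u′ ∉ E)
        side with u′ ∈? E
        ... | yes u′∈E = inj₁ (E⇒∈completion u′∈E u′∈U u′≢u)
        ... | no  u′∉E = inj₂ (u′≢i , u′≢j , u′∉E)

  -- From a resolving set to an `ℛ`-generator

  module _ {A : Subset n} (resolving : Resolving G I E A) where

    saturated? : ∀ x → Dec (∀ y → TrueTwins G x y → y ∈ I → y ∈ A)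
    saturated? x = all? λ y → twins? G x y →-dec ((y ∈? I) →-dec (y ∈? A))

    trace? : ∀ x → Dec (x ∈ XE × (∀ y → TrueTwins G x y → y ∈ I → y ∈ A))
    trace? x = (x ∈? XE) ×-dec saturated? x

    -- A twin class is traced at its representative when A contains all of its part of I.
    trace : Subset n
    trace = ⟦ trace? ⟧

    unsaturated : ∀ {x} → x ∈ XE → x ∉ trace → ∃ λ y → TrueTwins G x y × y ∈ I × y ∉ A
    unsaturated {x} x∈XE x∉ = decidable-stable
      (any? λ y → twins? G x y ×-dec ((y ∈? I) ×-dec ¬? (y ∈? A))) λ ∄y →
      x∉ (⟦⟧⁺ trace? (x∈XE , λ y x≈y y∈I → decidable-stable (y ∈? A) λ y∉A → ∄y (y , x≈y , y∈I , y∉A)))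

    -- If neither end of a related edge is traced, each has a twin in `I` outside `A`. The edge
    -- between these twins is resolved by some `l`, which also distinguishes the original ends;
    -- relatedness then forces `l` into `VE`, and so into `A` and the trace.
    trace-generator : RelatedGenerator trace
    trace-generator = proj₁ ∘ ⟦⟧⁻ trace? , distinguish
      where
      distinguish : ∀ x y → x ∈ XE → y ∈ XE → Related x y → ∃ λ s → s ∈ trace × d G s x ≢ d G s y
      distinguish x y x∈XE y∈XE (x~y , equidistant) with x ∈? trace | y ∈? trace
      ... | yes x∈ | _ = x , x∈ , λ eq → irrefl (d-separates eq) x~y
      ... | no _ | yes y∈ = y , y∈ , λ eq → irrefl (sym (d-separates (sym eq))) x~y
      ... | no x∉ | no y∉ with unsaturated x∈XE x∉ | unsaturated y∈XE y∉
      ...   | x′ , x≈x′ , x′∈I , x′∉A | y′ , y≈y′ , y′∈I , y′∉A = l , l∈trace , d≢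
        where
        x≉y : ¬ TrueTwins G x y
        x≉y x≈y = irrefl (XE-twins x∈XE y∈XE x≈y) x~y
        x′~y : x′ ~ y
        x′~y = twin-~ G x≈x′ (λ { refl → x≉y x≈x′ }) x~y
        y′~x′ : y′ ~ x′
        y′~x′ = twin-~ G y≈y′ (λ { refl → x≉y (trans x≈x′ (sym y≈y′)) }) (~-sym x′~y)
        witness = resolving (~-sym y′~x′) x′∈I y′∈I
        l = proj₁ witness
        d′≢ = proj₂ (proj₂ witness)
        l≢ = resolver-≢ (proj₁ (proj₂ witness)) x′∉A y′∉A
        l≢x′ = proj₁ l≢
        l≢y′ = proj₂ l≢
        -- As `x`, the vertex `l` would be a twin of `x′`, hence at distance 1 from both `x′` and
        -- `y′`.
        l≢x : l ≢ x
        l≢x l≡x = d′≢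
          (twin-equidistant G (subst (λ z → TrueTwins G z x′) (sym l≡x) x≈x′) (~-sym y′~x′) l≢x′ l≢y′)
        l≢y : l ≢ y
        l≢y l≡y = d′≢
          (sym (twin-equidistant G (subst (λ z → TrueTwins G z y′) (sym l≡y) y≈y′) y′~x′ l≢y′ l≢x′))
        d≢ : d G l x ≢ d G l y
        d≢ eq = d′≢ (trans (sym (d-twins G x≈x′ l≢x l≢x′)) (trans eq (d-twins G y≈y′ l≢y l≢y′)))
        -- Related vertices are equidistant from every other vertex outside `VE`.
        l∈VE : l ∈ VE
        l∈VE = decidable-stable (l ∈? VE) λ l∉VE → d≢ (equidistant l (∉∪pair⁺ l∉VE l≢x l≢y))
        l∈E : l ∈ E
        l∈E = p─q⊆p E ⋃U l∈VE
        l∉⋃U : l ∉ ⋃U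
        l∉⋃U = x∈p─q⇒x∉q E ⋃U l∈VE
        l∈A : l ∈ A
        l∈A with proj₁ (proj₂ witness)
        ... | inj₁ l∈A = l∈A
        ... | inj₂ (_ , _ , l∉E) = contradiction l∈E l∉E
        l∈XE : l ∈ XE
        l∈XE = x∈p∧x∉q⇒x∈p─q (E⊆I l∈E) λ l∈ →
          let j , l∈Rest = x∈⋃⁻ Rest l∈
          in  l∉⋃U (x∈⋃⁺ U j (proj₂ (x∈p∩q⁻ I (U j) (p─q⊆p (I ∩ U j) ⁅ c j ⁆ l∈Rest))))
        -- Since `l` is its own only twin, saturation at `l` reduces to `l ∈ A`.
        l∈trace : l ∈ trace
        l∈trace = ⟦⟧⁺ trace? (l∈XE , λ z l≈z _ → subst (_∈ A) (twin-of-singleton l∉⋃U l≈z) l∈A)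

    trace─⋃U⊆A : trace ─ ⋃U ⊆ A ─ ⋃U
    trace─⋃U⊆A x∈ =
      let x∈XE , sat = ⟦⟧⁻ trace? (p─q⊆p trace ⋃U x∈)
      in  x∈p∧x∉q⇒x∈p─q (sat _ refl (XE⊆I x∈XE)) (x∈p─q⇒x∉q trace ⋃U x∈)

    -- Twins are equidistant from every third vertex, so only membership of `x` or `y` in `A` can
    -- resolve them.
    twins-resolved : ∀ {x y} → TrueTwins G x y → x ≢ y → x ∈ I → y ∈ I → x ∉ A → y ∈ A
    twins-resolved x≈y x≢y x∈I y∈I x∉A with resolving (twins-adjacent G x≈y x≢y) x∈I y∈I
    ... | l , side , d≢ = decidable-stable (_ ∈? A) λ y∉A →
      let l≢x , l≢y = resolver-≢ side x∉A y∉A in d≢ (d-twins G x≈y l≢x l≢y)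

    -- `A` misses at most one vertex of `I ∩ U j`. If it misses none, the trace has at most `c j` in
    -- this class, which makes up for the `∸ 1`; if it misses `z`, no vertex of the class is
    -- saturated and the trace is empty there.
    ∣I∩U∣+∣trace∩U∣≤ : ∀ j →
      (if does (nonempty? (I ∩ U j)) then ∣ I ∩ U j ∣ ∸ 1 else 0) + ∣ trace ∩ U j ∣ ≤ ∣ A ∩ U j ∣
    ∣I∩U∣+∣trace∩U∣≤ j with nonempty? (I ∩ U j) | any? (λ z → (z ∈? I ∩ U j) ×-dec ¬? (z ∈? A))
    ... | no ∅ | _ = ∅⇒∣p∣≤ λ (_ , x∈) →
      let x∈trace , x∈U = x∈p∩q⁻ trace (U j) x∈
      in  ∅ (_ , x∈p∩q⁺ (XE⊆I (proj₁ (⟦⟧⁻ trace? x∈trace)) , x∈U))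
    ... | yes ne | no ∄z = begin
      ∣ I ∩ U j ∣ ∸ 1 + ∣ trace ∩ U j ∣ ≤⟨ ℕ.+-monoʳ-≤ _ (p⊆q⇒∣p∣≤∣q∣ only-c) ⟩
      ∣ I ∩ U j ∣ ∸ 1 + ∣ ⁅ c j ⁆ ∣     ≡⟨ cong (∣ I ∩ U j ∣ ∸ 1 +_) (∣⁅x⁆∣≡1 (c j)) ⟩
      ∣ I ∩ U j ∣ ∸ 1 + 1               ≡⟨ ℕ.m∸n+n≡m (x∈p⇒∣p∣>0 (proj₂ ne)) ⟩
      ∣ I ∩ U j ∣                       ≤⟨ p⊆q⇒∣p∣≤∣q∣ I∩U⊆A∩U ⟩
      ∣ A ∩ U j ∣                       ∎
      where
      open ℕ.≤-Reasoning
      only-c : trace ∩ U j ⊆ ⁅ c j ⁆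
      only-c x∈ =
        let x∈trace , x∈U = x∈p∩q⁻ trace (U j) x∈
        in  subst (_∈ ⁅ c j ⁆) (sym (XE-representative (proj₁ (⟦⟧⁻ trace? x∈trace)) x∈U)) (x∈⁅x⁆ (c j))
      I∩U⊆A∩U : I ∩ U j ⊆ A ∩ U j
      I∩U⊆A∩U {x} x∈ = x∈p∩q⁺ (decidable-stable (x ∈? A) (λ x∉A → ∄z (x , x∈ , x∉A)) , proj₂ (x∈p∩q⁻ I (U j) x∈))
    ... | yes _ | yes (z , z∈ , z∉A) = begin
      ∣ I ∩ U j ∣ ∸ 1 + ∣ trace ∩ U j ∣ ≤⟨ ℕ.+-monoʳ-≤ _ (p⊆q⇒∣p∣≤∣q∣ {q = ⊥} none) ⟩
      ∣ I ∩ U j ∣ ∸ 1 + ∣ ⊥ {n} ∣       ≡⟨ cong (∣ I ∩ U j ∣ ∸ 1 +_) (∣⊥∣≡0 n) ⟩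
      ∣ I ∩ U j ∣ ∸ 1 + 0               ≡⟨ ℕ.+-identityʳ _ ⟩
      ∣ I ∩ U j ∣ ∸ 1                   ≤⟨ ∣p∣∸1≤∣p-x∣ (I ∩ U j) z ⟩
      ∣ (I ∩ U j) - z ∣                 ≤⟨ p⊆q⇒∣p∣≤∣q∣ rest ⟩
      ∣ A ∩ U j ∣                       ∎
      where
      open ℕ.≤-Reasoning
      z∈I = proj₁ (x∈p∩q⁻ I (U j) z∈)
      z∈U = proj₂ (x∈p∩q⁻ I (U j) z∈)
      none : trace ∩ U j ⊆ ⊥
      none x∈ =
        let x∈trace , x∈U = x∈p∩q⁻ trace (U j) x∈
        in  contradiction (proj₂ (⟦⟧⁻ trace? x∈trace) z (class⁻ x∈U z∈U) z∈I) z∉A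
      rest : (I ∩ U j) - z ⊆ A ∩ U j
      rest {x} x∈ =
        let x∈I , x∈U = x∈p∩q⁻ I (U j) (p─q⊆p (I ∩ U j) ⁅ z ⁆ x∈)
            x≢z = λ x≡z → x∈p─q⇒x∉q (I ∩ U j) ⁅ z ⁆ x∈ (subst (_∈ ⁅ z ⁆) (sym x≡z) (x∈⁅x⁆ z))
        in  x∈p∩q⁺ (twins-resolved (class⁻ z∈U x∈U) (x≢z ∘ sym) z∈I x∈I z∉A , x∈U)

    ∣trace∣≤ : ∑Rest + ∣ trace ∣ ≤ ∣ A ∣
    ∣trace∣≤ = begin
      ∑Rest + ∣ trace ∣
        ≤⟨ ℕ.+-monoʳ-≤ ∑Rest (∣p∣≤∑∣p∩U∣+∣p─⋃U∣ trace U) ⟩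
      ∑Rest + (∑[ j < k ] ∣ trace ∩ U j ∣ + ∣ trace ─ ⋃U ∣)
        ≡⟨ ℕ.+-assoc ∑Rest _ _ ⟨
      ∑Rest + ∑[ j < k ] ∣ trace ∩ U j ∣ + ∣ trace ─ ⋃U ∣
        ≡⟨ cong (_+ ∣ trace ─ ⋃U ∣) (∑-distrib-+ size (λ j → ∣ trace ∩ U j ∣)) ⟨
      ∑[ j < k ] (size j + ∣ trace ∩ U j ∣) + ∣ trace ─ ⋃U ∣
        ≤⟨ ℕ.+-mono-≤ (sum-mono-≤ ∣I∩U∣+∣trace∩U∣≤) (p⊆q⇒∣p∣≤∣q∣ trace─⋃U⊆A) ⟩
      ∑[ j < k ] ∣ A ∩ U j ∣ + ∣ A ─ ⋃U ∣
        ≤⟨ ∑∣p∩U∣+∣p─⋃U∣≤∣p∣ A U disjoint ⟩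
      ∣ A ∣ ∎
      where
      open ℕ.≤-Reasoning
      size : Fin k → ℕ
      size j = if does (nonempty? (I ∩ U j)) then ∣ I ∩ U j ∣ ∸ 1 else 0

-- Minimum generators

[]-injective : ∀ {a b : ℕ} → [ a ] ≡ [ b ] → a ≡ b
[]-injective refl = refl

minimumSize≤ : {P : Pred (Subset n) 0ℓ} (P? : Unary.Decidable P) (p : ∃ P) →
  ∀ {T} → P T → minimumSize P? p ≤ ∣ T ∣
minimumSize≤ P? p {T} = proj₂ (proj₂ (minimum P? p)) T

module _ (G : Graph n) where
  open Graph G using (localGenerator?; ⊤-localGenerator; d-separates)

  dimₗ≤ : ∀ {S} → LocalMetricGenerator G S → dimₗ G ≤ ∣ S ∣
  dimₗ≤ = minimumSize≤ (localGenerator? (d G) _≟⁺_) (⊤-localGenerator (d G) d-separates)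

  metricBasis : ∃ λ S → LocalMetricGenerator G S × ∣ S ∣ ≡ dimₗ G
  metricBasis =
    let S , generator , _ = minimum (localGenerator? (d G) _≟⁺_) (⊤-localGenerator (d G) d-separates)
    in  S , generator , refl

-- Local adjacency generators

module _ (H : Graph m) where
  open Graph H using (_~_; _~?_; N; localGenerator?; ⊤-localGenerator; d₂-separates) renaming (sym to ~-sym)

  -- The positive form of the negation of `Covered`. In the product, `t` is not at distance 1 from
  -- `v` but is at distance 1 from every vertex of an adjacent copy, so it distinguishes the two.
  Spread : Subset m → Set
  Spread B = ∀ v → ∃ λ t → t ∈ B × ¬ t ~ v

  Covered : Subset m → Set
  Covered B = ∃ λ v → B ⊆ N v

  spread⊎covered : ∀ B → Spread B ⊎ Covered B
  spread⊎covered B with any? (λ v → B ⊆? N v)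
  ... | yes c  = inj₂ c
  ... | no  ∄v = inj₁ λ v → decidable-stable (any? λ t → (t ∈? B) ×-dec ¬? (t ~? v))
    λ ∄t → ∄v (v , λ {t} t∈B → ⟦⟧⁺ (v ~?_) (~-sym (decidable-stable (t ~? v) λ t≁v → ∄t (t , t∈B , t≁v))))

  adimₗ≤ : ∀ {S} → LocalAdjacencyGenerator H S → adimₗ H ≤ ∣ S ∣
  adimₗ≤ = minimumSize≤ (localGenerator? (d₂ H) ℕ._≟_) (⊤-localGenerator (d₂ H) d₂-separates)

  basis : ∃ λ B → LocalAdjacencyGenerator H B × ∣ B ∣ ≡ adimₗ H
  basis =
    let B , generator , _ = minimum (localGenerator? (d₂ H) ℕ._≟_) (⊤-localGenerator (d₂ H) d₂-separates)
    in  B , generator , refl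

  isBasis : ∀ {B} → LocalAdjacencyGenerator H B → ∣ B ∣ ≡ adimₗ H → LocalAdjacencyBasis H B
  isBasis gen ∣B∣≡ = gen , λ T genT → ℕ.≤-trans (ℕ.≤-reflexive ∣B∣≡) (adimₗ≤ genT)

  -- A finite search over subsets turns the failure of the universal statement `𝒢` into an explicit
  -- uncovered basis.
  ¬𝒢⇒spreadBasis : ¬ 𝒢 H → ∃ λ B → LocalAdjacencyGenerator H B × ∣ B ∣ ≤ adimₗ H × Spread B
  ¬𝒢⇒spreadBasis H∉𝒢 with anySubset? (λ B → localAdjacencyBasis? H B ×-dec ¬? (any? (λ v → B ⊆? N v)))
  ... | no ∄B = contradiction (λ B b → decidable-stable (any? (λ v → B ⊆? N v)) (λ ∄v → ∄B (B , b , ∄v))) H∉𝒢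
  ... | yes (B , (gen , min) , ¬cov) with spread⊎covered B
  ...   | inj₁ spread = B , gen , min _ (proj₁ (proj₂ basis)) , spread
  ...   | inj₂ cov    = contradiction cov ¬cov

  -- If every vertex of B is adjacent to v, then no neighbour of v is adjacent to all of B,
  -- as B distinguishes the two.
  spread-∪⁅⁆ : ∀ {B v} → LocalAdjacencyGenerator H B → B ⊆ N v → Spread (B ∪ ⁅ v ⁆)
  spread-∪⁅⁆ {B} {v} gen B⊆Nv w with v ~? w
  ... | no  v≁w = v , x∈p∪q⁺ (inj₂ (x∈⁅x⁆ v)) , v≁w
  ... | yes v~w with gen v w v~w
  ...   | s , s∈B , d₂≢ = s , x∈p∪q⁺ (inj₁ s∈B) , λ s~w →
    d₂≢ (trans (d₂-edge H (~-sym (⟦⟧⁻ (v ~?_) (B⊆Nv s∈B)))) (sym (d₂-edge H s~w)))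

  spreadGenerator : ∃ λ B → LocalAdjacencyGenerator H B × ∣ B ∣ ≤ adimₗ H + 1 × Spread B
  spreadGenerator with basis
  ... | B , gen , ∣B∣≡ with spread⊎covered B
  ...   | inj₁ spread    = B , gen , ℕ.≤-trans (ℕ.≤-reflexive ∣B∣≡) (ℕ.m≤m+n _ 1) , spread
  ...   | inj₂ (v , B⊆N) =
    B ∪ ⁅ v ⁆ ,
    (λ x y x~y → let s , s∈B , d₂≢ = gen x y x~y in s , x∈p∪q⁺ (inj₁ s∈B) , d₂≢) ,
    ℕ.≤-trans (∣p∪q∣≤∣p∣+∣q∣ B ⁅ v ⁆) (ℕ.≤-reflexive (cong₂ _+_ ∣B∣≡ (∣⁅x⁆∣≡1 v))) ,
    spread-∪⁅⁆ gen B⊆N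

  Φ⇒adimₗ≡0 : Φ H → adimₗ H ≡ 0
  Φ⇒adimₗ≡0 empty = ℕ.n≤0⇒n≡0
    (ℕ.≤-trans (adimₗ≤ {⊥} λ x y x~y → contradiction x~y (empty x y)) (ℕ.≤-reflexive (∣⊥∣≡0 m)))

  -- The only basis of an edgeless graph is empty, and it lies in the neighbourhood of any vertex.
  Φ⇒𝒢 : Fin m → Φ H → 𝒢 H
  Φ⇒𝒢 v empty B (_ , min) = v , λ x∈B → contradiction
    (ℕ.<-≤-trans (x∈p⇒∣p∣>0 x∈B) (min _ (proj₁ (proj₂ basis))))
    (ℕ.≤⇒≯ (ℕ.≤-reflexive (Φ⇒adimₗ≡0 empty)))

  ¬Φ⇒nonempty : ∀ {B} → LocalAdjacencyGenerator H B → ¬ Φ H → Nonempty B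
  ¬Φ⇒nonempty {B} gen ¬empty = decidable-stable (nonempty? B) λ ∄t →
    ¬empty λ x y x~y → let s , s∈B , _ = gen x y x~y in ∄t (s , s∈B)

-- The lexicographic product

-- A walk to some other vertex has a first edge. The neighbour provides the detours of length 2
-- between vertices of one copy.
neighbour : (G : Graph n) → 2 ≤ n → Connected G → ∀ x → ∃ λ y → Graph._~_ G x y
neighbour G (s≤s (s≤s _)) conn x = first (other x) (proj₂ (conn x (proj₁ (other x))))
  where
  other : ∀ {n} (x : Fin (suc (suc n))) → ∃ (x ≢_)
  other zero    = suc zero , λ ()
  other (suc _) = zero , λ ()
  first : ∀ {x k} (y : ∃ (x ≢_)) → Walk G x (proj₁ y) k → ∃ λ y → Graph._~_ G x y
  first (_ , x≢x) []      = contradiction refl x≢x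
  first _         (e ∷ _) = _ , e

module Product (G : Graph n) (2≤n : 2 ≤ n) (connected : Connected G)
  {m : Fin n → ℕ} (nonZero : ∀ i → NonZero (m i)) (H : ∀ i → Graph (m i)) where

  open Lexicographic G H using (_~_; across; within)

  private
    P = G ∘ₗ H
    module G = Graph G
    module P = Graph P
    Vertex = Σ (Fin n) (Fin ∘ m)

  point : ∀ i → Fin (m i)
  point i with m i | nonZero i
  ... | suc _ | _ = zero

  edge⁺ : ∀ {u v : Vertex} → u ~ v → flatten m u P.~ flatten m v
  edge⁺ = subst₂ _~_ (sym (unflatten-flatten m _)) (sym (unflatten-flatten m _))

  edge⁻ : ∀ {u v : Vertex} → flatten m u P.~ flatten m v → u ~ v
  edge⁻ = subst₂ _~_ (unflatten-flatten m _) (unflatten-flatten m _)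

  row : Fin (sum m) → Fin n
  row p = proj₁ (unflatten m p)

  -- Steps inside a copy collapse, so the length does not grow.
  project : ∀ {p q} → P ⟨ p , q ⟩≽ G ⟨ row p , row q ⟩
  project []      = _ , z≤n , []
  project (e ∷ w) with project w | step e
    where
    step : ∀ {u v} → u ~ v → proj₁ u G.~ proj₁ v ⊎ proj₁ u ≡ proj₁ v
    step (across e) = inj₁ e
    step (within _) = inj₂ refl
  ... | _ , j≤k , v | inj₁ e′ = _ , s≤s j≤k , e′ ∷ v
  ... | _ , j≤k , v | inj₂ eq = _ , ℕ.m≤n⇒m≤1+n j≤k , subst (λ i → Walk G i _ _) (sym eq) v

  -- The length is positive because an empty walk cannot lead from `v` to a different `w`; inner
  -- vertices are chosen arbitrarily by `point`.
  lift : ∀ {i j v w k} → Walk G i j (suc k) → Walk P (flatten m (i , v)) (flatten m (j , w)) (suc k)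
  lift         (e ∷ [])              = edge⁺ (across e) ∷ []
  lift {w = w} (_∷_ {y = z} e (e′ ∷ u)) = edge⁺ (across e) ∷ lift {v = point z} {w} (e′ ∷ u)

  d-across : ∀ {i j} → i ≢ j → ∀ v w → d P (flatten m (i , v)) (flatten m (j , w)) ≡ d G i j
  d-across {i} {j} i≢j v w = d-cong to from
    where
    to : P ⟨ flatten m (i , v) , flatten m (j , w) ⟩≽ G ⟨ i , j ⟩
    to u = let k , k≤ , u′ = project u in
      k , k≤ , subst₂ (λ x y → Walk G (proj₁ x) (proj₁ y) k)
        (unflatten-flatten m (i , v)) (unflatten-flatten m (j , w)) u′
    from : G ⟨ i , j ⟩≽ P ⟨ flatten m (i , v) , flatten m (j , w) ⟩
    from []        = contradiction refl i≢j
    from u@(_ ∷ _) = _ , ℕ.≤-refl , lift u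

  -- The detour through a neighbouring copy caps the distance at 2, even between different
  -- components of `H i`.
  d-within : ∀ i v w → d P (flatten m (i , v)) (flatten m (i , w)) ≡ [ d₂ (H i) v w ]
  d-within i v w with Graph._~?_ (H i) v w | v ≟ w
  ... | yes e | _ = trans (d-edge P (edge⁺ (within e))) (cong [_] (sym (d₂-edge (H i) e)))
  ... | no _  | yes refl = trans (d-refl P _) (cong [_] (sym (d₂-refl (H i) v)))
  ... | no ¬e | no v≢w = trans
    (d-far P (λ eq → v≢w (injective eq)) (λ e → ¬within (edge⁻ e))
      (edge⁺ (across e) ∷ (edge⁺ {z , point z} {i , w} (across (G.sym e)) ∷ [])))
    (cong [_] (sym (d₂-far (H i) v≢w ¬e)))
    where
    z = proj₁ (neighbour G 2≤n connected i)
    e = proj₂ (neighbour G 2≤n connected i)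
    ¬within : ¬ (i , v) ~ (i , w)
    ¬within (across e) = G.irrefl refl e
    ¬within (within e) = ¬e e
    injective : flatten m (i , v) ≡ flatten m (i , w) → v ≡ w
    injective eq with
      trans (sym (unflatten-flatten m (i , v))) (trans (cong (unflatten m) eq) (unflatten-flatten m (i , w)))
    ... | refl = refl

  -- Vertex sets of the product and their fibres

  fibre : Subset (sum m) → ∀ i → Subset (m i)
  fibre S i = tabulate (λ v → lookup S (flatten m (i , v)))

  ∣S∣≡∑∣fibre∣ : ∀ S → ∣ S ∣ ≡ ∑[ i < n ] ∣ fibre S i ∣
  ∣S∣≡∑∣fibre∣ S = trans (cong ∣_∣ (sym (tabulate∘lookup S))) (∣tabulate-flatten∣ m (lookup S))

  ∈fibre : ∀ {S i v} → flatten m (i , v) ∈ S → v ∈ fibre S i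
  ∈fibre {S} {i} {v} ∈S = lookup⇒[]= v _ (trans (lookup∘tabulate _ v) ([]=⇒lookup ∈S))

  bundle : (∀ i → Subset (m i)) → Subset (sum m)
  bundle B = tabulate (λ p → uncurry (λ i → lookup (B i)) (unflatten m p))

  ∣bundle∣≡∑ : ∀ B → ∣ bundle B ∣ ≡ ∑[ i < n ] ∣ B i ∣
  ∣bundle∣≡∑ B = trans (∣tabulate-flatten∣ m _) (sum-cong-≗ λ i → cong ∣_∣
    (trans (tabulate-cong λ v → cong (uncurry (λ i → lookup (B i))) (unflatten-flatten m (i , v)))
      (tabulate∘lookup (B i))))

  ∈bundle : ∀ B {i v} → v ∈ B i → flatten m (i , v) ∈ bundle B
  ∈bundle B {i} {v} v∈B = lookup⇒[]= _ _ (begin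
    lookup (bundle B) (flatten m (i , v))       ≡⟨ lookup∘tabulate _ (flatten m (i , v)) ⟩
    member (unflatten m (flatten m (i , v)))    ≡⟨ cong member (unflatten-flatten m (i , v)) ⟩
    lookup (B i) v                              ≡⟨ []=⇒lookup v∈B ⟩
    inside                                      ∎)
    where
    open ≡-Reasoning
    member = uncurry (λ i → lookup (B i))

  -- Stated for pairs instead of elements of `Fin (sum m)`, so that edges can be matched as `across`
  -- or `within`.
  Distinguishes : Subset (sum m) → Vertex → Vertex → Set
  Distinguishes S u v = ∃₂ λ l t → flatten m (l , t) ∈ S ×
    d P (flatten m (l , t)) (flatten m u) ≢ d P (flatten m (l , t)) (flatten m v)

  generator⁻ : ∀ {S} → LocalMetricGenerator P S → ∀ {u v} → u ~ v → Distinguishes S u v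
  generator⁻ {S} gen {u} {v} u~v =
    let s , s∈S , d≢ = gen _ _ (edge⁺ u~v)
        eq = sym (flatten-unflatten m s)
    in  row s , proj₂ (unflatten m s) , subst (_∈ S) eq s∈S ,
        subst (λ s → d P s (flatten m u) ≢ d P s (flatten m v)) eq d≢

  generator⁺ : ∀ {S} → (∀ {u v} → u ~ v → Distinguishes S u v) → LocalMetricGenerator P S
  generator⁺ gen p q p~q =
    let l , t , ∈S , d≢ = gen p~q
    in  flatten m (l , t) , ∈S ,
        subst₂ (λ p q → d P (flatten m (l , t)) p ≢ d P (flatten m (l , t)) q)
          (flatten-unflatten m p) (flatten-unflatten m q) d≢

  Edgeless : Subset n
  Edgeless = ⟦ (λ i → Φ? (H i)) ⟧

  Φ⇒∈Edgeless : ∀ {i} → Φ (H i) → i ∈ Edgeless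
  Φ⇒∈Edgeless = ⟦⟧⁺ (λ i → Φ? (H i))

  ∈Edgeless⇒Φ : ∀ {i} → i ∈ Edgeless → Φ (H i)
  ∈Edgeless⇒Φ = ⟦⟧⁻ (λ i → Φ? (H i))

  𝒢⇒∈I : ∀ {i} → 𝒢 (H i) → i ∈ I H
  𝒢⇒∈I = ⟦⟧⁺ (λ i → 𝒢? (H i))

  ∈I⇒𝒢 : ∀ {i} → i ∈ I H → 𝒢 (H i)
  ∈I⇒𝒢 = ⟦⟧⁻ (λ i → 𝒢? (H i))

  Edgeless⊆I : Edgeless ⊆ I H
  Edgeless⊆I {i} i∈ = 𝒢⇒∈I (Φ⇒𝒢 (H i) (point i) (∈Edgeless⇒Φ i∈))

  -- From a generator of the product to a resolving set

  module _ {S} (gen : LocalMetricGenerator P S) where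

    -- A vertex of another copy is equidistant from all vertices of copy `i`, so the fibre has to do
    -- all the work inside it.
    fibre-generator : ∀ i → LocalAdjacencyGenerator (H i) (fibre S i)
    fibre-generator i v w v~w with generator⁻ gen (within v~w)
    ... | l , t , ∈S , d≢ with l ≟ i
    ...   | yes refl = t , ∈fibre ∈S , λ d₂≡ →
      d≢ (trans (d-within i t v) (trans (cong [_] d₂≡) (sym (d-within i t w))))
    ...   | no  l≢i  = contradiction (trans (d-across l≢i t v) (sym (d-across l≢i t w))) d≢

    excess? : ∀ i → Dec (∣ fibre S i ∣ ≢ adimₗ (H i))
    excess? i = ¬? (∣ fibre S i ∣ ℕ.≟ adimₗ (H i))

    -- Fibres have at least `adimₗ` vertices, so these are the copies with at least one extra
    -- vertex; every other fibre is a basis.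
    Excess : Subset n
    Excess = ⟦ excess? ⟧

    fibre-basis : ∀ {i} → i ∉ Excess → LocalAdjacencyBasis (H i) (fibre S i)
    fibre-basis {i} i∉ = isBasis (H i) (fibre-generator i)
      (decidable-stable (∣ fibre S i ∣ ℕ.≟ adimₗ (H i)) (λ ≢ → i∉ (⟦⟧⁺ excess? ≢)))

    adimₗ+excess≤ : ∀ i → adimₗ (H i) + indicator Excess i ≤ ∣ fibre S i ∣
    adimₗ+excess≤ i with i ∈? Excess
    ... | yes i∈ rewrite indicator-∈ i∈ | ℕ.+-comm (adimₗ (H i)) 1 =
      ℕ.≤∧≢⇒< (adimₗ≤ (H i) (fibre-generator i)) (⟦⟧⁻ excess? i∈ ∘ sym)
    ... | no  i∉ rewrite indicator-∉ i∉ | ℕ.+-identityʳ (adimₗ (H i)) = adimₗ≤ (H i) (fibre-generator i)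

    ∑adimₗ+∣excess∣≤ : ∑[ i < n ] adimₗ (H i) + ∣ Excess ∣ ≤ ∣ S ∣
    ∑adimₗ+∣excess∣≤ = begin
      ∑[ i < n ] adimₗ (H i) + ∣ Excess ∣
        ≡⟨ cong (∑[ i < n ] adimₗ (H i) +_) (∣p∣≡∑indicator Excess) ⟩
      ∑[ i < n ] adimₗ (H i) + ∑[ i < n ] indicator Excess i
        ≡⟨ ∑-distrib-+ (λ i → adimₗ (H i)) (indicator Excess) ⟨
      ∑[ i < n ] (adimₗ (H i) + indicator Excess i)
        ≤⟨ sum-mono-≤ adimₗ+excess≤ ⟩
      ∑[ i < n ] ∣ fibre S i ∣
        ≡⟨ ∣S∣≡∑∣fibre∣ S ⟨
      ∣ S ∣ ∎
      where open ℕ.≤-Reasoning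

    -- Both distances are 1: `t` is adjacent to the covering vertex `v` and to all of the adjacent
    -- copy `j`.
    covered-equidistant : ∀ {i j v t} w → i G.~ j → fibre S i ⊆ Graph.N (H i) v → flatten m (i , t) ∈ S →
      d P (flatten m (i , t)) (flatten m (i , v)) ≡ d P (flatten m (i , t)) (flatten m (j , w))
    covered-equidistant {i} {j} {v} {t} w i~j cov ∈S = begin
      d P (flatten m (i , t)) (flatten m (i , v)) ≡⟨ d-within i t v ⟩
      [ d₂ (H i) t v ]                            ≡⟨ cong [_] (d₂-edge (H i) t~v) ⟩
      [ 1 ]                                       ≡⟨ d-edge G i~j ⟨
      d G i j                                     ≡⟨ d-across (λ i≡j → G.irrefl i≡j i~j) t w ⟨
      d P (flatten m (i , t)) (flatten m (j , w)) ∎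
      where
      open ≡-Reasoning
      t~v : Graph._~_ (H i) t v
      t~v = Graph.sym (H i) (⟦⟧⁻ (Graph._~?_ (H i) v) (cov (∈fibre ∈S)))

    -- If neither end is in `Excess`, both fibres are bases covered by vertices `v` and `w`. Neither
    -- fibre distinguishes `(i , v)` from `(j , w)`, so a third copy must.
    resolving-excess : Resolving G (I H) Edgeless Excess
    resolving-excess {i} {j} i~j i∈I j∈I with i ∈? Excess | j ∈? Excess
    ... | yes i∈ | _ = i , inj₁ i∈ , λ eq → G.irrefl (G.d-separates eq) i~j
    ... | no _ | yes j∈ = j , inj₁ j∈ , λ eq → G.irrefl (sym (G.d-separates (sym eq))) i~j
    ... | no i∉ | no j∉ with ∈I⇒𝒢 i∈I _ (fibre-basis i∉) | ∈I⇒𝒢 j∈I _ (fibre-basis j∉)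
    ...   | v , covᵢ | w , covⱼ with generator⁻ gen {i , v} {j , w} (across i~j)
    ...     | l , t , ∈S , d≢ with l ≟ i | l ≟ j
    ...       | yes refl | _        = contradiction (covered-equidistant w i~j covᵢ ∈S) d≢
    ...       | no _     | yes refl = contradiction (sym (covered-equidistant v (G.sym i~j) covⱼ ∈S)) d≢
    ...       | no l≢i   | no l≢j   = l , side , λ eq →
      d≢ (trans (d-across l≢i t v) (trans eq (sym (d-across l≢j t w))))
      where
      side : l ∈ Excess ⊎ (l ≢ i × l ≢ j × l ∉ Edgeless)
      side with l ∈? Edgeless
      ... | no  l∉ = inj₂ (l≢i , l≢j , l∉)
      -- For edgeless `H l` the value `adimₗ` is 0, while the fibre contains `t`.
      ... | yes l∈ = inj₁ (⟦⟧⁺ excess? λ eq →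
        ℕ.n>0⇒n≢0 (x∈p⇒∣p∣>0 (∈fibre ∈S)) (trans eq (Φ⇒adimₗ≡0 (H l) (∈Edgeless⇒Φ l∈))))

  -- From a resolving set to a generator of the product

  chosen : (A : Subset n) → ∀ i → ∃ λ B →
    LocalAdjacencyGenerator (H i) B ×
    ∣ B ∣ ≤ adimₗ (H i) + indicator A i ×
    (i ∈ A ⊎ i ∉ I H → Spread (H i) B)
  chosen A i with i ∈? A | i ∈? I H
  -- The unit contributed by `indicator A i` pays for making the generator spread.
  ... | yes i∈A | _ rewrite indicator-∈ i∈A =
    let B , gen , ≤ , spread = spreadGenerator (H i)
    in  B , gen , ≤ , λ _ → spread
  -- Outside `I H` some basis is already spread.
  ... | no _ | no i∉I =
    let B , gen , ≤ , spread = ¬𝒢⇒spreadBasis (H i) (i∉I ∘ 𝒢⇒∈I)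
    in  B , gen , ℕ.≤-trans ≤ (ℕ.m≤m+n _ _) , λ _ → spread
  ... | no i∉A | yes i∈I =
    let B , gen , eq = basis (H i)
    in  B , gen , ℕ.≤-trans (ℕ.≤-reflexive eq) (ℕ.m≤m+n _ _) ,
        λ { (inj₁ i∈A) → contradiction i∈A i∉A ; (inj₂ i∉I) → contradiction i∈I i∉I }

  module _ {A : Subset n} (resolving : Resolving G (I H) Edgeless A)
    (B : ∀ i → Subset (m i)) (B-generator : ∀ i → LocalAdjacencyGenerator (H i) (B i))
    (B-spread : ∀ {i} → i ∈ A ⊎ i ∉ I H → Spread (H i) (B i)) where

    spread-distinguishes : ∀ {i j v} w → i G.~ j → Spread (H i) (B i) →
      Distinguishes (bundle B) (i , v) (j , w)
    spread-distinguishes {i} {j} {v} w i~j spread =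
      let t , t∈B , t≁v = spread v
      in  i , t , ∈bundle B t∈B , λ eq → t≁v (d₂≡1⇒~ (H i) ([]-injective (begin
            [ d₂ (H i) t v ]                            ≡⟨ d-within i t v ⟨
            d P (flatten m (i , t)) (flatten m (i , v)) ≡⟨ eq ⟩
            d P (flatten m (i , t)) (flatten m (j , w)) ≡⟨ d-across (λ i≡j → G.irrefl i≡j i~j) t w ⟩
            d G i j                                     ≡⟨ d-edge G i~j ⟩
            [ 1 ]                                       ∎)))
      where open ≡-Reasoning

    swap : ∀ u v → Distinguishes (bundle B) u v → Distinguishes (bundle B) v u
    swap _ _ (l , t , ∈S , d≢) = l , t , ∈S , d≢ ∘ sym

    -- Edges within a copy are left to `B i`, and edges across to an end whose `B` is spread. If
    -- both ends lie in `I H` but not in `A`, any vertex chosen in the resolving copy `l` works, so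
    -- `B l` only has to be nonempty.
    bundle-generator : LocalMetricGenerator P (bundle B)
    bundle-generator = generator⁺ distinguishes
      where
      distinguishes : ∀ {u v} → u ~ v → Distinguishes (bundle B) u v
      distinguishes (within {i} {v} {w} v~w) =
        let t , t∈B , d₂≢ = B-generator i v w v~w
        in  i , t , ∈bundle B t∈B , λ eq →
              d₂≢ ([]-injective (trans (sym (d-within i t v)) (trans eq (d-within i t w))))
      distinguishes (across {i} {j} {v} {w} i~j) with i ∈? A | j ∈? A | i ∈? I H | j ∈? I H
      ... | yes i∈A | _ | _ | _ = spread-distinguishes w i~j (B-spread (inj₁ i∈A))
      ... | _ | yes j∈A | _ | _ = swap (j , w) (i , v) (spread-distinguishes v (G.sym i~j) (B-spread (inj₁ j∈A)))
      ... | _ | _ | no ∉I | _ = spread-distinguishes w i~j (B-spread (inj₂ ∉I))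
      ... | _ | _ | _ | no ∉I = swap (j , w) (i , v) (spread-distinguishes v (G.sym i~j) (B-spread (inj₂ ∉I)))
      ... | no i∉A | no j∉A | yes i∈I | yes j∈I with resolving i~j i∈I j∈I
      ...   | l , inj₁ l∈A , d≢ =
        -- Spreadness at an arbitrary vertex is used only to obtain an element of `B l`.
        let t , t∈B , _ = B-spread (inj₁ l∈A) (point l)
            l≢i , l≢j = resolver-≢ {P = l ∉ Edgeless} (inj₁ l∈A) i∉A j∉A
        in  l , t , ∈bundle B t∈B , λ eq →
              d≢ (trans (sym (d-across l≢i t v)) (trans eq (d-across l≢j t w)))
      ...   | l , inj₂ (l≢i , l≢j , l∉) , d≢ =
        let t , t∈B = ¬Φ⇒nonempty (H l) (B-generator l) (l∉ ∘ Φ⇒∈Edgeless)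
        in  l , t , ∈bundle B t∈B , λ eq →
              d≢ (trans (sym (d-across l≢i t v)) (trans eq (d-across l≢j t w)))

  lower-bound : ∀ {S} → LocalMetricGenerator P S →
    ∃ λ A → Resolving G (I H) Edgeless A × ∑[ i < n ] adimₗ (H i) + ∣ A ∣ ≤ ∣ S ∣
  lower-bound gen = Excess gen , resolving-excess gen , ∑adimₗ+∣excess∣≤ gen

  upper-bound : ∀ {A} → Resolving G (I H) Edgeless A →
    ∃ λ S → LocalMetricGenerator P S × ∣ S ∣ ≤ ∑[ i < n ] adimₗ (H i) + ∣ A ∣
  upper-bound {A} resolving =
    bundle B ,
    bundle-generator resolving B (λ i → proj₁ (proj₂ (chosen A i))) (λ {i} → proj₂ (proj₂ (proj₂ (chosen A i)))) ,
    (begin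
      ∣ bundle B ∣
        ≡⟨ ∣bundle∣≡∑ B ⟩
      ∑[ i < n ] ∣ B i ∣
        ≤⟨ sum-mono-≤ (λ i → proj₁ (proj₂ (proj₂ (chosen A i)))) ⟩
      ∑[ i < n ] (adimₗ (H i) + indicator A i)
        ≡⟨ ∑-distrib-+ (λ i → adimₗ (H i)) (indicator A) ⟩
      ∑[ i < n ] adimₗ (H i) + ∑[ i < n ] indicator A i
        ≡⟨ cong (∑[ i < n ] adimₗ (H i) +_) (∣p∣≡∑indicator A) ⟨
      ∑[ i < n ] adimₗ (H i) + ∣ A ∣ ∎)
    where
    open ℕ.≤-Reasoning
    B : ∀ i → Subset (m i)
    B i = proj₁ (chosen A i)

-- The two bounds combined

theorem2 : ∀ {n} (G : Graph n) → 2 ≤ n → Graph.Connected G →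
    ∀ {m : Fin n → ℕ} → (∀ i → NonZero (m i)) →
    (H : ∀ i → Graph (m i)) →
    ∀ {k} (U : Fin k → Subset n) → NonsingletonTwinClasses G U →
    (c : Fin k → Fin n) → Choice H U c →
    dimₗ (G ∘ₗ H) ≡
    (∑[ i < n ] adimₗ (H i))
    + (∑[ j < k ] (if does (nonempty? (I H ∩ U j)) then ∣ I H ∩ U j ∣ ∸ 1 else 0))
    + ϱ H U c G
theorem2 {n} G 2≤n connected nonZero H {k} U classes c choice =
  trans (ℕ.≤-antisym upper lower) (sym (ℕ.+-assoc ∑adimₗ ∑Rest (ϱ H U c G)))
  where
  open Product G 2≤n connected nonZero H
  open Representatives G classes c Edgeless⊆I
  open ℕ.≤-Reasoning
  ∑adimₗ = ∑[ i < n ] adimₗ (H i)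
  upper : dimₗ (G ∘ₗ H) ≤ ∑adimₗ + (∑Rest + ϱ H U c G)
  upper =
    let A , generator , _ = minimum (ℛ-generator? H U c G) (X-E-generator H U c G)
        S , S-generator , ∣S∣≤ = upper-bound (resolving-completion choice generator)
    in  begin
          dimₗ (G ∘ₗ H)                             ≤⟨ dimₗ≤ (G ∘ₗ H) S-generator ⟩
          ∣ S ∣                                     ≤⟨ ∣S∣≤ ⟩
          ∑adimₗ + ∣ completion choice generator ∣  ≤⟨ ℕ.+-monoʳ-≤ ∑adimₗ (∣completion∣≤ choice generator) ⟩
          ∑adimₗ + (∑Rest + ϱ H U c G)              ∎
  ϱ≤ : ∀ {A} (resolving : Resolving G (I H) Edgeless A) → ϱ H U c G ≤ ∣ trace resolving ∣
  ϱ≤ resolving =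
    minimumSize≤ (ℛ-generator? H U c G) (X-E-generator H U c G) (trace-generator resolving)
  lower : ∑adimₗ + (∑Rest + ϱ H U c G) ≤ dimₗ (G ∘ₗ H)
  lower =
    let S , S-generator , ∣S∣≡ = metricBasis (G ∘ₗ H)
        A , resolving , ∣A∣≤ = lower-bound S-generator
    in  begin
          ∑adimₗ + (∑Rest + ϱ H U c G)           ≤⟨ ℕ.+-monoʳ-≤ ∑adimₗ (ℕ.+-monoʳ-≤ ∑Rest (ϱ≤ resolving)) ⟩
          ∑adimₗ + (∑Rest + ∣ trace resolving ∣) ≤⟨ ℕ.+-monoʳ-≤ ∑adimₗ (∣trace∣≤ resolving) ⟩
          ∑adimₗ + ∣ A ∣                         ≤⟨ ∣A∣≤ ⟩
          ∣ S ∣                                  ≡⟨ ∣S∣≡ ⟩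
          dimₗ (G ∘ₗ H)                          ∎
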